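{- Let $p$ be an odd prime and let $a\in\mathbb{F}_p$ with $a^5\not\equiv a \pmod p$. Let $E/\mathbb{F}_p$ be the elliptic curve given by the Edwards model $X^2+Y^2=a^2(1+X^2Y^2)$. Then \[|E(\mathbb{F}_p)|=1+p+p\cdot{_2F_1}\left(\begin{matrix}\phi&\phi \\ {} & \epsilon\end{matrix}\Big| 1-a^4\right).\]
   Context: $|E(\mathbb{F}_p)|$ is the number of $\mathbb{F}_p$-rational points of the elliptic curve (the smooth projective curve birational to the given affine model). Multiplicative characters $\chi$ of $\mathbb{F}_p^\times$ are extended by $\chi(0)=0$; $\epsilon$ is the trivial and $\phi$ the quadratic character; $\overline{\chi}=1/\chi$. For characters $A,B$: ${A\choose B}:=\frac{B(-1)}{p}\sum_{x\in\mathbb{F}_p}A(x)\overline{B}(1-x)$. The Gaussian hypergeometric series is \[{_2F_1}\left(\begin{matrix}\phi&\phi \\ {} & \epsilon\end{matrix}\Big| x\right):=\frac{p}{p-1}\sum_{\chi}{\phi\chi\choose\chi}{\phi\chi\choose\chi}\chi(x),\] the sum running over all multiplicative characters $\chi$ of $\mathbb{F}_p$. -}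

module Defs where

open import Level using (Level; _⊔_) renaming (suc to lsuc)
open import Algebra.Bundles using (CommutativeRing)
open import Data.Empty using (⊥; ⊥-elim)
open import Data.Fin.Base as Fin using (Fin; toℕ; fromℕ; inject₁; fromℕ<)
import Data.Fin.Properties as Fin
open import Data.List.Base using (List; []; _∷_; length; map; filter; allFin; tabulate; lookup; cartesianProduct; cartesianProductWith)
import Data.List.Membership.Setoid as Membership
import Data.List.Membership.Setoid.Properties as MembershipProperties
open import Data.List.Relation.Unary.All using (All; []; _∷_)
import Data.List.Relation.Unary.All.Properties as All
open import Data.List.Relation.Unary.AllPairs using ([]; _∷_)
open import Data.List.Relation.Unary.Any using (here; there)
import Data.List.Relation.Unary.Unique.Setoid as Unique
import Data.List.Relation.Unary.Unique.Setoid.Properties as Unique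
open import Data.Nat.Base as ℕ using (ℕ; zero; suc; NonZero; z≤n; s≤s; _!)
open import Data.Nat.Combinatorics using (_C_; nCn≡1; nCk≡nC[n∸k])
open import Data.Nat.Combinatorics.Specification using (nCk≡n!/k![n-k]!; [n∸k]!k!∣n!)
open import Data.Nat.Divisibility using (_∣_; ∣⇒≤; n∣m⇒m%n≡0; ∣m⇒∣m*n; m∣m*n)
open import Data.Nat.DivMod using (_%_; _mod_; %-distribˡ-+; %-distribˡ-*; m<n⇒m%n≡m; m%n<n; n%n≡0; m*[n/m]≡n)
open import Data.Nat.Primality using (Prime; euclidsLemma; prime⇒nonTrivial)
import Data.Nat.Properties as ℕ
open import Data.Product.Base using (_×_; _,_; ∃; proj₁; proj₂; uncurry)
open import Data.Sum.Base using (_⊎_; inj₁; inj₂)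
import Data.Vec.Functional as Vector
import Data.Vec.Functional.Relation.Binary.Equality.Setoid as VectorEquality
open import Function.Base using (_∘_)
open import Function.Bundles using (_⇔_; mk⇔)
open import Relation.Binary.Definitions using (Decidable; tri<; tri≈; tri>)
open import Relation.Binary.PropositionalEquality as ≡ using (_≡_)
open import Relation.Nullary.Decidable using (Dec; yes; no; map′; _×-dec_)
open import Relation.Nullary.Negation using (¬_; contradiction)
import Algebra.Properties.Ring as RingProperties
import Algebra.Properties.Semiring.Exp as Exp
import Algebra.Properties.CommutativeSemiring.Exp as CommutativeExp
import Algebra.Properties.Semiring.Mult as Mult
import Algebra.Properties.Semiring.Sum as Sum
import Algebra.Properties.CommutativeMonoid.Sum as CommutativeSum
import Algebra.Properties.CommutativeSemiring.Binomial as Binomial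
import Relation.Binary.Reasoning.Setoid as SetoidReasoning

private variable
  c ℓ : Level

------------------------------------------------------------------------
-- Fields

-- Fields in the classical sense: every element is zero or invertible,
-- so equality is decidable.  The inverse is made total by 0⁻¹ = 0.

record Field c ℓ : Set (lsuc (c ⊔ ℓ)) where
  infix  4 _≟_
  infix  9 _⁻¹
  field
    commutativeRing : CommutativeRing c ℓ
  open CommutativeRing commutativeRing public
  field
    1≉0     : ¬ 1# ≈ 0#
    _≟_     : Decidable _≈_
    inverse : ∀ x → ¬ x ≈ 0# → ∃ λ y → x * y ≈ 1#

  open Exp semiring public using (_^_)
  open Mult semiring public using () renaming (_×_ to _·_)

  _⁻¹ : Carrier → Carrier
  x ⁻¹ with x ≟ 0#
  ... | yes _  = 0#
  ... | no x≉0 = proj₁ (inverse x x≉0)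

  fromℕ# : ℕ → Carrier
  fromℕ# n = n · 1#

  CharacteristicZero : Set ℓ
  CharacteristicZero = ∀ n .{{_ : NonZero n}} → ¬ fromℕ# n ≈ 0#

  record IsPrimitiveRootOfUnity (n : ℕ) (ζ : Carrier) : Set ℓ where
    field
      ζ^n≈1 : ζ ^ n ≈ 1#
      ζ^k≉1 : ∀ k → 0 ℕ.< k → k ℕ.< n → ¬ ζ ^ k ≈ 1#

------------------------------------------------------------------------
-- The ring 𝔽ₚ of residues modulo p

module Residues (p : ℕ) .{{_ : NonZero p}} where

  [_] : ℕ → Fin p
  [ m ] = m mod p

  _⊕_ _⊛_ : Fin p → Fin p → Fin p
  x ⊕ y = [ toℕ x ℕ.+ toℕ y ]
  x ⊛ y = [ toℕ x ℕ.* toℕ y ]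

  ⊖_ : Fin p → Fin p
  ⊖ x = [ p ℕ.∸ toℕ x ]

  toℕ-[] : ∀ m → toℕ [ m ] ≡ m % p
  toℕ-[] m = Fin.toℕ-fromℕ< (m%n<n m p)

  []-cong : ∀ {m n} → m % p ≡ n % p → [ m ] ≡ [ n ]
  []-cong {m} {n} eq = Fin.toℕ-injective (≡.trans (toℕ-[] m) (≡.trans eq (≡.sym (toℕ-[] n))))

  []-toℕ : ∀ x → [ toℕ x ] ≡ x
  []-toℕ x = Fin.toℕ-injective (≡.trans (toℕ-[] (toℕ x)) (m<n⇒m%n≡m (Fin.toℕ<n x)))

  []-+ : ∀ m n → [ m ] ⊕ [ n ] ≡ [ m ℕ.+ n ]
  []-+ m n = []-cong (≡.trans
    (≡.cong₂ (λ u v → (u ℕ.+ v) % p) (toℕ-[] m) (toℕ-[] n))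
    (≡.sym (%-distribˡ-+ m n p)))

  []-* : ∀ m n → [ m ] ⊛ [ n ] ≡ [ m ℕ.* n ]
  []-* m n = []-cong (≡.trans
    (≡.cong₂ (λ u v → (u ℕ.* v) % p) (toℕ-[] m) (toℕ-[] n))
    (≡.sym (%-distribˡ-* m n p)))

  []-+ˡ : ∀ m z → [ m ] ⊕ z ≡ [ m ℕ.+ toℕ z ]
  []-+ˡ m z = ≡.trans (≡.cong ([ m ] ⊕_) (≡.sym ([]-toℕ z))) ([]-+ m (toℕ z))

  []-*ˡ : ∀ m z → [ m ] ⊛ z ≡ [ m ℕ.* toℕ z ]
  []-*ˡ m z = ≡.trans (≡.cong ([ m ] ⊛_) (≡.sym ([]-toℕ z))) ([]-* m (toℕ z))

  ⊕-comm : ∀ x y → x ⊕ y ≡ y ⊕ x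
  ⊕-comm x y = ≡.cong [_] (ℕ.+-comm (toℕ x) (toℕ y))

  ⊛-comm : ∀ x y → x ⊛ y ≡ y ⊛ x
  ⊛-comm x y = ≡.cong [_] (ℕ.*-comm (toℕ x) (toℕ y))

  ⊕-assoc : ∀ x y z → (x ⊕ y) ⊕ z ≡ x ⊕ (y ⊕ z)
  ⊕-assoc x y z = ≡.trans ([]-+ˡ _ z) (≡.trans
    (≡.cong [_] (≡.trans (ℕ.+-assoc (toℕ x) (toℕ y) (toℕ z)) (ℕ.+-comm (toℕ x) _)))
    (≡.trans (≡.sym ([]-+ˡ _ x)) (⊕-comm (y ⊕ z) x)))

  ⊛-assoc : ∀ x y z → (x ⊛ y) ⊛ z ≡ x ⊛ (y ⊛ z)
  ⊛-assoc x y z = ≡.trans ([]-*ˡ _ z) (≡.trans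
    (≡.cong [_] (≡.trans (ℕ.*-assoc (toℕ x) (toℕ y) (toℕ z)) (ℕ.*-comm (toℕ x) _)))
    (≡.trans (≡.sym ([]-*ˡ _ x)) (⊛-comm (y ⊛ z) x)))

  ⊕-identityˡ : ∀ x → [ 0 ] ⊕ x ≡ x
  ⊕-identityˡ x = ≡.trans ([]-+ˡ 0 x) ([]-toℕ x)

  ⊛-identityˡ : ∀ x → [ 1 ] ⊛ x ≡ x
  ⊛-identityˡ x = ≡.trans ([]-*ˡ 1 x) (≡.trans (≡.cong [_] (ℕ.*-identityˡ (toℕ x))) ([]-toℕ x))

  ⊖-inverseˡ : ∀ x → (⊖ x) ⊕ x ≡ [ 0 ]
  ⊖-inverseˡ x = ≡.trans ([]-+ˡ _ x) ([]-cong (≡.trans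
    (≡.cong (_% p) (ℕ.m∸n+n≡m (ℕ.<⇒≤ (Fin.toℕ<n x))))
    (≡.trans (n%n≡0 p) (≡.sym (m<n⇒m%n≡m (ℕ.>-nonZero⁻¹ p))))))

  ⊛-distribʳ : ∀ x y z → (y ⊕ z) ⊛ x ≡ (y ⊛ x) ⊕ (z ⊛ x)
  ⊛-distribʳ x y z = ≡.trans ([]-*ˡ _ x) (≡.trans
    (≡.cong [_] (ℕ.*-distribʳ-+ (toℕ x) (toℕ y) (toℕ z)))
    (≡.sym ([]-+ _ _)))

  𝔽 : CommutativeRing _ _
  𝔽 = record
    { Carrier = Fin p
    ; _≈_ = _≡_
    ; _+_ = _⊕_
    ; _*_ = _⊛_
    ; -_  = ⊖_
    ; 0#  = [ 0 ]
    ; 1#  = [ 1 ]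
    ; isCommutativeRing = record
      { isRing = record
        { +-isAbelianGroup = record
          { isGroup = record
            { isMonoid = record
              { isSemigroup = record
                { isMagma = record { isEquivalence = ≡.isEquivalence ; ∙-cong = ≡.cong₂ _⊕_ }
                ; assoc = ⊕-assoc
                }
              ; identity = ⊕-identityˡ , λ x → ≡.trans (⊕-comm x _) (⊕-identityˡ x)
              }
            ; inverse = ⊖-inverseˡ , λ x → ≡.trans (⊕-comm x _) (⊖-inverseˡ x)
            ; ⁻¹-cong = ≡.cong ⊖_
            }
          ; comm = ⊕-comm
          }
        ; *-cong = ≡.cong₂ _⊛_
        ; *-assoc = ⊛-assoc
        ; *-identity = ⊛-identityˡ , λ x → ≡.trans (⊛-comm x _) (⊛-identityˡ x)
        ; distrib = (λ x y z → ≡.trans (⊛-comm x _) (≡.trans (⊛-distribʳ x y z) (≡.cong₂ _⊕_ (⊛-comm y x) (⊛-comm z x)))) , ⊛-distribʳ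
        }
      ; *-comm = ⊛-comm
      }
    }

open Residues public using (𝔽)

------------------------------------------------------------------------
-- The curve X² + Y² = a²(1 + X²Y²) and its smooth projective model

-- The model is the closure in ℙ¹ × ℙ¹ of the affine curve, obtained by
-- homogenising each variable separately.  A point is a pair
-- ((X : Z) , (Y : T)); the chart Z = T = 1 is the affine curve
-- (Edwards-affine), and for a⁵ ≠ a in odd characteristic the closure has no
-- geometric singular point (FieldProperties.Edwards-smooth).  Hence it is the
-- smooth projective curve birational to the affine one.  Its points at
-- infinity have X/Z = ∞, T/Y = ± a or Y/T = ∞, Z/X = ± a.

module _ (R : CommutativeRing c ℓ) where
  open CommutativeRing R
  open Exp semiring using (_^_)

  OnEdwards : Carrier → Carrier × Carrier → Carrier × Carrier → Set ℓ
  OnEdwards a (X , Z) (Y , T) =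
    X ^ 2 * T ^ 2 + Y ^ 2 * Z ^ 2 ≈ a ^ 2 * (Z ^ 2 * T ^ 2 + X ^ 2 * Y ^ 2)

  -- All four partial derivatives of
  -- X²T² + Y²Z² - a²(Z²T² + X²Y²) vanish.
  record SingularEdwards (a : Carrier) (P Q : Carrier × Carrier) : Set ℓ where
    private
      X = proj₁ P
      Z = proj₂ P
      Y = proj₁ Q
      T = proj₂ Q
      2# = 1# + 1#
    field
      ∂X : 2# * X * (T ^ 2 - a ^ 2 * Y ^ 2) ≈ 0#
      ∂Y : 2# * Y * (Z ^ 2 - a ^ 2 * X ^ 2) ≈ 0#
      ∂Z : 2# * Z * (Y ^ 2 - a ^ 2 * T ^ 2) ≈ 0#
      ∂T : 2# * T * (X ^ 2 - a ^ 2 * Z ^ 2) ≈ 0#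

  Edwards-affine : ∀ a x y → OnEdwards a (x , 1#) (y , 1#) ⇔
                   x ^ 2 + y ^ 2 ≈ a ^ 2 * (1# + x ^ 2 * y ^ 2)
  Edwards-affine a x y = mk⇔
    (λ eq → trans (sym left) (trans eq right))
    (λ eq → trans left (trans eq (sym right)))
    where
    1² : 1# ^ 2 ≈ 1#
    1² = trans (*-identityˡ _) (*-identityʳ 1#)
    ·1² : ∀ z → z * 1# ^ 2 ≈ z
    ·1² z = trans (*-congˡ 1²) (*-identityʳ z)
    left : x ^ 2 * 1# ^ 2 + y ^ 2 * 1# ^ 2 ≈ x ^ 2 + y ^ 2
    left = +-cong (·1² _) (·1² _)
    right : a ^ 2 * (1# ^ 2 * 1# ^ 2 + x ^ 2 * y ^ 2) ≈ a ^ 2 * (1# + x ^ 2 * y ^ 2)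
    right = *-congˡ (+-congʳ (trans (·1² _) 1²))

-- The number of 𝔽ₚ-points of the model.  Every point of ℙ¹(𝔽ₚ) has
-- exactly one representative among (1 : 0) and (x : 1).

module _ (p : ℕ) .{{_ : NonZero p}} where
  open CommutativeRing (𝔽 p) using (0#; 1#; _+_; _*_)
  open Exp (CommutativeRing.semiring (𝔽 p)) using (_^_)

  ℙ¹ : List (Fin p × Fin p)
  ℙ¹ = (1# , 0#) ∷ map (_, 1#) (allFin p)

  onEdwards? : ∀ a (PQ : (Fin p × Fin p) × (Fin p × Fin p)) → Dec (uncurry (OnEdwards (𝔽 p) a) PQ)
  onEdwards? a ((X , Z) , (Y , T)) =
    X ^ 2 * T ^ 2 + Y ^ 2 * Z ^ 2 Fin.≟ a ^ 2 * (Z ^ 2 * T ^ 2 + X ^ 2 * Y ^ 2)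

  ∣Edwards∣ : Fin p → ℕ
  ∣Edwards∣ a = length (filter (onEdwards? a) (cartesianProduct ℙ¹ ℙ¹))

------------------------------------------------------------------------
-- Multiplicative characters of 𝔽ₚ with values in a field K

-- K stands for ℂ, or any other field of characteristic zero containing the
-- (p-1)-th roots of unity, such as ℚ(ζ).

module _ (p : ℕ) .{{_ : NonZero p}} (K : Field c ℓ) where
  open Field K
  open Sum semiring using (sum)
  private module 𝔽ₚ = CommutativeRing (𝔽 p)

  -- Extended by χ(0) = 0.
  record IsCharacter (χ : Fin p → Carrier) : Set ℓ where
    field
      χ-0 : χ 𝔽ₚ.0# ≈ 0#
      χ-1 : χ 𝔽ₚ.1# ≈ 1#
      χ-* : ∀ x y → χ (x 𝔽ₚ.* y) ≈ χ x * χ y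

  isCharacter? : ∀ χ → Dec (IsCharacter χ)
  isCharacter? χ = map′
    (λ (a , b , c) → record { χ-0 = a ; χ-1 = b ; χ-* = c })
    (λ h → let open IsCharacter h in χ-0 , χ-1 , χ-*)
    (χ 𝔽ₚ.0# ≟ 0# ×-dec χ 𝔽ₚ.1# ≟ 1# ×-dec
     Fin.all? (λ x → Fin.all? (λ y → χ (x 𝔽ₚ.* y) ≟ χ x * χ y)))

  functions : ∀ n → List Carrier → List (Fin n → Carrier)
  functions zero    vs = (λ ()) ∷ []
  functions (suc n) vs = cartesianProductWith Vector._∷_ vs (functions n vs)

  -- All characters, given a primitive (p-1)-th root of unity ζ: the
  -- multiplicative functions with values in {0, 1, ζ, …, ζᵖ⁻²}.  Every
  -- character occurs exactly once: see CharacterProperties.∈-characters and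
  -- CharacterProperties.characters-unique.
  values : Carrier → List Carrier
  values ζ = 0# ∷ tabulate {n = p ℕ.∸ 1} (λ i → ζ ^ toℕ i)

  characters : Carrier → List (Fin p → Carrier)
  characters ζ = filter isCharacter? (functions p (values ζ))

  φ : Fin p → Carrier
  φ x with x Fin.≟ 𝔽ₚ.0# | Fin.any? (λ y → y 𝔽ₚ.* y Fin.≟ x)
  ... | yes _ | _     = 0#
  ... | no _  | yes _ = 1#
  ... | no _  | no _  = - 1#

  infixl 7 _⊙_
  _⊙_ : (A B : Fin p → Carrier) → Fin p → Carrier
  (A ⊙ B) x = A x * B x

  -- As 0⁻¹ = 0, this vanishes at 0.
  conjugate : (Fin p → Carrier) → Fin p → Carrier
  conjugate A x = A x ⁻¹

  binom : (A B : Fin p → Carrier) → Carrier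
  binom A B = B (𝔽ₚ.- 𝔽ₚ.1#) * fromℕ# p ⁻¹ * sum (λ x → A x * conjugate B (𝔽ₚ.1# 𝔽ₚ.- x))

  -- The series ₂F₁(φ, φ; ε | x).
  ₂F₁ : Carrier → Fin p → Carrier
  ₂F₁ ζ x = fromℕ# p * fromℕ# (p ℕ.∸ 1) ⁻¹ *
    sum (λ i → let χ = lookup (characters ζ) i in binom (φ ⊙ χ) χ * binom (φ ⊙ χ) χ * χ x)

------------------------------------------------------------------------
-- Smoothness of the model, and completeness of the list of characters

module FieldProperties (K : Field c ℓ) where
  open Field K
  open RingProperties ring using (x∙y⁻¹≈ε⇒x≈y)
  open SetoidReasoning setoid

  zeroProduct : ∀ {x y} → x * y ≈ 0# → x ≈ 0# ⊎ y ≈ 0#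
  zeroProduct {x} {y} xy≈0 with x ≟ 0#
  ... | yes x≈0 = inj₁ x≈0
  ... | no  x≉0 = let x⁻¹ , xx⁻¹≈1 = inverse x x≉0 in inj₂ (begin
    y              ≈⟨ *-identityˡ y ⟨
    1# * y         ≈⟨ *-congʳ (trans (*-comm x⁻¹ x) xx⁻¹≈1) ⟨
    x⁻¹ * x * y    ≈⟨ *-assoc x⁻¹ x y ⟩
    x⁻¹ * (x * y)  ≈⟨ *-congˡ xy≈0 ⟩
    x⁻¹ * 0#       ≈⟨ zeroʳ x⁻¹ ⟩
    0#             ∎)

  *-cancelʳ : ∀ {x y z} → ¬ z ≈ 0# → x * z ≈ y * z → x ≈ y
  *-cancelʳ {x} {y} {z} z≉0 eq with zeroProduct (begin
    (x - y) * z        ≈⟨ distribʳ z x (- y) ⟩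
    x * z + - y * z    ≈⟨ +-cong eq (sym (RingProperties.-‿distribˡ-* ring y z)) ⟩
    y * z - y * z      ≈⟨ -‿inverseʳ (y * z) ⟩
    0#                 ∎)
  ... | inj₁ x-y≈0 = x∙y⁻¹≈ε⇒x≈y x y x-y≈0
  ... | inj₂ z≈0   = contradiction z≈0 z≉0

  ^-zero : ∀ {x} n → x ^ n ≈ 0# → x ≈ 0#
  ^-zero zero    1≈0 = contradiction 1≈0 1≉0
  ^-zero (suc n) eq with zeroProduct eq
  ... | inj₁ x≈0  = x≈0
  ... | inj₂ xⁿ≈0 = ^-zero n xⁿ≈0

  -- K may be any extension field of 𝔽ₚ, so this is geometric smoothness.
  Edwards-smooth : ¬ 1# + 1# ≈ 0# → ∀ {a} → ¬ a ^ 5 ≈ a →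
    ∀ {X Z Y T} → ¬ (X ≈ 0# × Z ≈ 0#) → ¬ (Y ≈ 0# × T ≈ 0#) →
    ¬ SingularEdwards commutativeRing a (X , Z) (Y , T)
  Edwards-smooth 2≉0 {a} a⁵≉a {X} {Z} {Y} {T} XZ≉0 YT≉0 sing =
    cases (X ≟ 0#) (split ∂X) (split ∂Y) (split ∂Z) (split ∂T)
    where
    open SingularEdwards sing
    split : ∀ {W u v} → (1# + 1#) * W * (u - v) ≈ 0# → W ≈ 0# ⊎ u ≈ v
    split eq with zeroProduct eq
    ... | inj₂ u-v≈0 = inj₂ (x∙y⁻¹≈ε⇒x≈y _ _ u-v≈0)
    ... | inj₁ 2W≈0 with zeroProduct 2W≈0
    ...   | inj₁ 2≈0 = contradiction 2≈0 2≉0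
    ...   | inj₂ W≈0 = inj₁ W≈0
    a≉0 : ¬ a ≈ 0#
    a≉0 a≈0 = a⁵≉a (trans (*-congʳ a≈0) (trans (zeroˡ _) (sym a≈0)))
    square-zero : ∀ {u v} → u ^ 2 ≈ a ^ 2 * v ^ 2 → v ≈ 0# → u ≈ 0#
    square-zero eq v≈0 = ^-zero 2 (trans eq
      (trans (*-congˡ (trans (*-congʳ v≈0) (zeroˡ _))) (zeroʳ _)))
    square-zero⁻ : ∀ {u v} → u ^ 2 ≈ a ^ 2 * v ^ 2 → u ≈ 0# → v ≈ 0#
    square-zero⁻ eq u≈0
      with zeroProduct (trans (sym eq) (trans (*-congʳ u≈0) (zeroˡ _)))
    ... | inj₁ a²≈0 = contradiction (^-zero 2 a²≈0) a≉0
    ... | inj₂ v²≈0 = ^-zero 2 v²≈0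
    cases : Dec (X ≈ 0#) →
      X ≈ 0# ⊎ T ^ 2 ≈ a ^ 2 * Y ^ 2 → Y ≈ 0# ⊎ Z ^ 2 ≈ a ^ 2 * X ^ 2 →
      Z ≈ 0# ⊎ Y ^ 2 ≈ a ^ 2 * T ^ 2 → T ≈ 0# ⊎ X ^ 2 ≈ a ^ 2 * Z ^ 2 → ⊥
    cases (yes X≈0) _ (inj₂ ∂Y) _ _ = XZ≉0 (X≈0 , square-zero ∂Y X≈0)
    cases (yes X≈0) _ (inj₁ Y≈0) (inj₁ Z≈0) _ = XZ≉0 (X≈0 , Z≈0)
    cases (yes X≈0) _ (inj₁ Y≈0) (inj₂ ∂Z) _ = YT≉0 (Y≈0 , square-zero⁻ ∂Z Y≈0)
    cases (no X≉0) (inj₁ X≈0) _ _ _ = X≉0 X≈0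
    cases (no X≉0) (inj₂ ∂X) _ _ (inj₁ T≈0) = YT≉0 (square-zero⁻ ∂X T≈0 , T≈0)
    cases (no X≉0) (inj₂ ∂X) _ (inj₁ Z≈0) (inj₂ ∂T) = X≉0 (square-zero ∂T Z≈0)
    cases (no X≉0) (inj₂ ∂X) _ (inj₂ ∂Z) (inj₂ _) = a⁵≉a (begin
      a ^ 5  ≈⟨ *-congˡ (*-cancelʳ Y²≉0 (begin
        a ^ 4 * Y ^ 2            ≈⟨ *-congʳ (Exp.^-homo-* semiring a 2 2) ⟩
        a ^ 2 * a ^ 2 * Y ^ 2    ≈⟨ *-assoc _ _ _ ⟩
        a ^ 2 * (a ^ 2 * Y ^ 2)  ≈⟨ *-congˡ ∂X ⟨
        a ^ 2 * T ^ 2            ≈⟨ ∂Z ⟨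
        Y ^ 2                    ≈⟨ *-identityˡ _ ⟨
        1# * Y ^ 2               ∎)) ⟩
      a * 1# ≈⟨ *-identityʳ a ⟩
      a      ∎)
      where
      Y²≉0 : ¬ Y ^ 2 ≈ 0#
      Y²≉0 Y²≈0 = YT≉0 (^-zero 2 Y²≈0 , square-zero ∂X (^-zero 2 Y²≈0))

  module _ {n ζ} (charZero : CharacteristicZero) (prim : IsPrimitiveRootOfUnity n ζ) (0<n : 0 ℕ.< n) where
    open IsPrimitiveRootOfUnity prim
    open Sum semiring using (sum; sum-init-last; sum-cong-≋; *-distribˡ-sum; sum-replicate; sum-replicate-zero)
    open CommutativeSum +-commutativeMonoid using (∑-comm)
    open Exp semiring using (^-congˡ; ^-congʳ; ^-homo-*; ^-assocʳ)
    open CommutativeExp commutativeSemiring using (^-distrib-*)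

    1^ : ∀ m → 1# ^ m ≈ 1#
    1^ zero    = refl
    1^ (suc m) = trans (*-identityˡ _) (1^ m)

    geometric : ∀ z m → z ^ m ≈ 1# → ¬ z ≈ 1# → sum {m} (λ k → z ^ toℕ k) ≈ 0#
    geometric z m zᵐ≈1 z≉1 with zeroProduct (begin
      (z - 1#) * S         ≈⟨ distribʳ S z (- 1#) ⟩
      z * S + - 1# * S     ≈⟨ +-cong zS≈S (RingProperties.-1*x≈-x ring S) ⟩
      S - S                ≈⟨ -‿inverseʳ S ⟩
      0#                   ∎)
      where
      S = sum {m} (λ k → z ^ toℕ k)
      zS≈S : z * S ≈ S
      zS≈S = RingProperties.+-cancelˡ ring 1# _ _ (begin
        1# + z * S                          ≈⟨ +-congˡ (*-distribˡ-sum z (λ k → z ^ toℕ {m} k)) ⟩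
        sum {suc m} (λ k → z ^ toℕ k)       ≈⟨ sum-init-last (λ k → z ^ toℕ {suc m} k) ⟩
        sum {m} (λ k → z ^ toℕ (inject₁ k)) + z ^ toℕ (fromℕ m)
          ≈⟨ +-cong (sum-cong-≋ {m} (λ k → ^-congʳ z (Fin.toℕ-inject₁ k)))
                    (trans (^-congʳ z (Fin.toℕ-fromℕ m)) zᵐ≈1) ⟩
        S + 1#                              ≈⟨ +-comm S 1# ⟩
        1# + S                              ∎)
    ... | inj₁ z-1≈0 = contradiction (x∙y⁻¹≈ε⇒x≈y _ _ z-1≈0) z≉1
    ... | inj₂ S≈0   = S≈0

    -- Otherwise Σᵢ Σₖ (y ζⁱ)ᵏ is 0 when summed over k first, and n when
    -- summed over i first.
    root-of-unity : ∀ y → y ^ n ≈ 1# → ∃ λ (i : Fin n) → y ≈ ζ ^ toℕ i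
    root-of-unity y yⁿ≈1 with Fin.any? (λ (i : Fin n) → y * ζ ^ toℕ i ≟ 1#)
    ... | yes (i , eq) = found (toℕ i) (ℕ.<⇒≤ (Fin.toℕ<n i)) eq
      where
      found : ∀ m → m ℕ.≤ n → y * ζ ^ m ≈ 1# → ∃ λ (i : Fin n) → y ≈ ζ ^ toℕ i
      found zero    _   eq = fromℕ< 0<n , trans (sym (*-identityʳ y)) (trans eq (^-congʳ ζ (≡.sym (Fin.toℕ-fromℕ< 0<n))))
      found m@(suc _) m≤n eq = fromℕ< n∸m<n , (begin
        y                              ≈⟨ *-identityʳ y ⟨
        y * 1#                         ≈⟨ *-congˡ ζ^n≈1 ⟨
        y * ζ ^ n                      ≈⟨ *-congˡ (^-congʳ ζ (≡.sym (ℕ.m+[n∸m]≡n m≤n))) ⟩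
        y * ζ ^ (m ℕ.+ (n ℕ.∸ m))      ≈⟨ *-congˡ (^-homo-* ζ m (n ℕ.∸ m)) ⟩
        y * (ζ ^ m * ζ ^ (n ℕ.∸ m))    ≈⟨ *-assoc _ _ _ ⟨
        y * ζ ^ m * ζ ^ (n ℕ.∸ m)      ≈⟨ *-congʳ eq ⟩
        1# * ζ ^ (n ℕ.∸ m)             ≈⟨ *-identityˡ _ ⟩
        ζ ^ (n ℕ.∸ m)                  ≈⟨ ^-congʳ ζ (≡.sym (Fin.toℕ-fromℕ< n∸m<n)) ⟩
        ζ ^ toℕ (fromℕ< n∸m<n)         ∎)
        where
        n∸m<n : n ℕ.∸ m ℕ.< n
        n∸m<n = ℕ.∸-monoʳ-< (s≤s z≤n) m≤n
    ... | no none = ⊥-elim (n≉0 (begin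
        fromℕ# n                                          ≈⟨ byColumns 0<n {ℕ.≤-refl} ⟨
        sum {n} (λ k → sum {n} (λ i → z i ^ toℕ k))       ≈⟨ ∑-comm {n} {n} (λ k i → z i ^ toℕ k) ⟩
        sum {n} (λ i → sum {n} (λ k → z i ^ toℕ k))       ≈⟨ sum-cong-≋ {n} (λ i → geometric (z i) n (zⁿ≈1 i) (λ eq → none (i , eq))) ⟩
        sum (Vector.replicate n 0#)                       ≈⟨ sum-replicate-zero n ⟩
        0#                                                ∎))
      where
      n≉0 : ¬ fromℕ# n ≈ 0#
      n≉0 = charZero n {{ℕ.>-nonZero 0<n}}
      z : Fin n → Carrier
      z i = y * ζ ^ toℕ i
      swap : ∀ i k → (ζ ^ i) ^ k ≈ (ζ ^ k) ^ i
      swap i k = trans (^-assocʳ ζ i k) (trans (^-congʳ ζ (ℕ.*-comm i k)) (sym (^-assocʳ ζ k i)))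
      ζᵏ : ∀ i → (ζ ^ i) ^ n ≈ 1#
      ζᵏ i = trans (swap i n) (trans (^-congˡ i ζ^n≈1) (1^ i))
      zⁿ≈1 : ∀ i → z i ^ n ≈ 1#
      zⁿ≈1 i = trans (^-distrib-* y (ζ ^ toℕ i) n) (trans (*-cong yⁿ≈1 (ζᵏ (toℕ i))) (*-identityˡ 1#))
      column : ∀ k → 0 ℕ.< k → k ℕ.< n → sum {n} (λ i → z i ^ k) ≈ 0#
      column k 0<k k<n = begin
        sum {n} (λ i → z i ^ k)                  ≈⟨ sum-cong-≋ {n} (λ i → trans (^-distrib-* y (ζ ^ toℕ i) k) (*-congˡ (swap (toℕ i) k))) ⟩
        sum {n} (λ i → y ^ k * (ζ ^ k) ^ toℕ i)  ≈⟨ *-distribˡ-sum (y ^ k) (λ i → (ζ ^ k) ^ toℕ {n} i) ⟨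
        y ^ k * sum {n} (λ i → (ζ ^ k) ^ toℕ i)  ≈⟨ *-congˡ (geometric (ζ ^ k) n (ζᵏ k) (ζ^k≉1 k 0<k k<n)) ⟩
        y ^ k * 0#                               ≈⟨ zeroʳ _ ⟩
        0#                                       ∎
      byColumns : ∀ {m} → 0 ℕ.< m → {m≤n : m ℕ.≤ n} → sum {m} (λ k → sum {n} (λ i → z i ^ toℕ k)) ≈ fromℕ# n
      byColumns {suc m} _ {m≤n} = begin
        sum {n} (λ i → 1#) + sum {m} (λ k → sum {n} (λ i → z i ^ suc (toℕ k)))
          ≈⟨ +-cong (sum-replicate n) (sum-cong-≋ {m} (λ k → column (suc (toℕ k)) (s≤s z≤n) (ℕ.<-≤-trans (s≤s (Fin.toℕ<n k)) m≤n))) ⟩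
        fromℕ# n + sum (Vector.replicate m 0#)    ≈⟨ +-congˡ (sum-replicate-zero m) ⟩
        fromℕ# n + 0#                             ≈⟨ +-identityʳ _ ⟩
        fromℕ# n                                  ∎

    ζ^≉0 : ∀ {k} → k ℕ.< n → ¬ ζ ^ k ≈ 0#
    ζ^≉0 {k} k<n ζᵏ≈0 = 1≉0 (begin
      1#                        ≈⟨ ζ^n≈1 ⟨
      ζ ^ n                     ≈⟨ ^-congʳ ζ (≡.sym (ℕ.m+[n∸m]≡n (ℕ.<⇒≤ k<n))) ⟩
      ζ ^ (k ℕ.+ (n ℕ.∸ k))     ≈⟨ ^-homo-* ζ k (n ℕ.∸ k) ⟩
      ζ ^ k * ζ ^ (n ℕ.∸ k)     ≈⟨ *-congʳ ζᵏ≈0 ⟩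
      0# * ζ ^ (n ℕ.∸ k)        ≈⟨ zeroˡ _ ⟩
      0#                        ∎)

    ζ-distinct : ∀ {k m} → k ℕ.< m → m ℕ.< n → ¬ ζ ^ m ≈ ζ ^ k
    ζ-distinct {k} {m} k<m m<n eq =
      ζ^k≉1 (m ℕ.∸ k) (ℕ.m<n⇒0<n∸m k<m) (ℕ.≤-<-trans (ℕ.m∸n≤m m k) m<n) (*-cancelʳ (ζ^≉0 (ℕ.<-trans k<m m<n)) (begin
        ζ ^ (m ℕ.∸ k) * ζ ^ k    ≈⟨ ^-homo-* ζ (m ℕ.∸ k) k ⟨
        ζ ^ (m ℕ.∸ k ℕ.+ k)      ≈⟨ ^-congʳ ζ (ℕ.m∸n+n≡m (ℕ.<⇒≤ k<m)) ⟩
        ζ ^ m                    ≈⟨ eq ⟩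
        ζ ^ k                    ≈⟨ *-identityˡ _ ⟨
        1# * ζ ^ k               ∎))

    ζ-injective : ∀ {i j : Fin n} → ζ ^ toℕ i ≈ ζ ^ toℕ j → i ≡ j
    ζ-injective {i} {j} eq with ℕ.<-cmp (toℕ i) (toℕ j)
    ... | tri< i<j _ _ = contradiction (sym eq) (ζ-distinct i<j (Fin.toℕ<n j))
    ... | tri≈ _ i≡j _ = Fin.toℕ-injective i≡j
    ... | tri> _ _ j<i = contradiction eq (ζ-distinct j<i (Fin.toℕ<n i))

module 𝔽-Properties (p : ℕ) .{{_ : NonZero p}} (prime : Prime p) where
  open CommutativeRing (𝔽 p)
  open Exp semiring using (_^_)
  open Mult semiring using () renaming (_×_ to _·_)
  open Sum semiring using (sum; sum-init-last; sum-cong-≋; sum-replicate-zero)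

  private
    1<p : 1 ℕ.< p
    1<p = ℕ.nonTrivial⇒n>1 p {{prime⇒nonTrivial prime}}

  p∤! : ∀ k → k ℕ.< p → ¬ p ∣ k !
  p∤! zero    _   p∣1 = contradiction (∣⇒≤ p∣1) (ℕ.<⇒≱ 1<p)
  p∤! (suc k) k<p p∣  with euclidsLemma (suc k) (k !) prime p∣
  ... | inj₁ p∣k  = contradiction (∣⇒≤ p∣k) (ℕ.<⇒≱ k<p)
  ... | inj₂ p∣k! = p∤! k (ℕ.<-trans (ℕ.n<1+n k) k<p) p∣k!

  p∣p! : ∀ {m} → 0 ℕ.< m → m ∣ m !
  p∣p! {suc m} _ = m∣m*n (m !)

  p∣pCk : ∀ k → 0 ℕ.< k → k ℕ.< p → p ∣ p C k
  p∣pCk k 0<k k<p with euclidsLemma (k ! ℕ.* (p ℕ.∸ k) !) (p C k) prime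
    (≡.subst (p ∣_) (≡.sym eq) (p∣p! (ℕ.>-nonZero⁻¹ p)))
    where
    instance _ = k ℕ.!* (p ℕ.∸ k) !≢0
    k≤p = ℕ.<⇒≤ k<p
    eq : k ! ℕ.* (p ℕ.∸ k) ! ℕ.* (p C k) ≡ p !
    eq = ≡.trans (≡.cong (k ! ℕ.* (p ℕ.∸ k) ! ℕ.*_) (nCk≡n!/k![n-k]! k≤p))
      (m*[n/m]≡n (≡.subst (_∣ p !) (ℕ.*-comm ((p ℕ.∸ k) !) (k !)) ([n∸k]!k!∣n! k≤p)))
  ... | inj₂ p∣C = p∣C
  ... | inj₁ p∣! with euclidsLemma (k !) ((p ℕ.∸ k) !) prime p∣!
  ...   | inj₁ p∣k!     = contradiction p∣k! (p∤! k k<p)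
  ...   | inj₂ p∣[p-k]! = contradiction p∣[p-k]! (p∤! (p ℕ.∸ k) (ℕ.∸-monoʳ-< 0<k (ℕ.<⇒≤ k<p)))

  sum-ends : ∀ {m} (t : Fin (suc m) → Carrier) → 0 ℕ.< m →
             (∀ k → 0 ℕ.< toℕ k → toℕ k ℕ.< m → t k ≡ 0#) →
             sum t ≡ t Fin.zero + t (fromℕ m)
  sum-ends {suc m} t _ middle = ≡.cong (t Fin.zero +_) (≡.trans
    (sum-init-last (t ∘ Fin.suc))
    (≡.trans (≡.cong (_+ t (fromℕ (suc m))) (≡.trans
        (sum-cong-≋ {m} (λ k → middle (Fin.suc (inject₁ k)) (s≤s z≤n)
          (s≤s (≡.subst (ℕ._< m) (≡.sym (Fin.toℕ-inject₁ k)) (Fin.toℕ<n k)))))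
        (sum-replicate-zero m)))
      (+-identityˡ _)))

  ·-mod : ∀ m x → m · x ≡ (m ℕ.* toℕ x) mod p
  ·-mod zero    x = ≡.refl
  ·-mod (suc m) x = ≡.trans
    (≡.cong₂ _+_ (≡.sym (Residues.[]-toℕ p x)) (·-mod m x))
    (Residues.[]-+ p (toℕ x) (m ℕ.* toℕ x))

  ∣⇒·≡0 : ∀ {m} x → p ∣ m → m · x ≡ 0#
  ∣⇒·≡0 {m} x p∣m = ≡.trans (·-mod m x) (Residues.[]-cong p (≡.trans
    (n∣m⇒m%n≡0 (m ℕ.* toℕ x) p (∣m⇒∣m*n (toℕ x) p∣m))
    (≡.sym (m<n⇒m%n≡m (ℕ.>-nonZero⁻¹ p)))))

  frobenius : ∀ x y → (x + y) ^ p ≡ x ^ p + y ^ p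
  frobenius x y = ≡.trans (Binomial.theorem commutativeSemiring p x y)
    (≡.trans (sum-ends (Binomial.binomialTerm commutativeSemiring x y p) (ℕ.>-nonZero⁻¹ p)
        (λ k 0<k k<p → ∣⇒·≡0 _ (p∣pCk (toℕ k) 0<k k<p)))
      (≡.trans (≡.cong₂ _+_ first last) (+-comm (y ^ p) (x ^ p))))
    where
    first : (p C 0) · (x ^ 0 * y ^ p) ≡ y ^ p
    first = ≡.trans (≡.cong (_· (1# * y ^ p)) (≡.trans (nCk≡nC[n∸k] {0} {p} z≤n) (nCn≡1 p)))
      (≡.trans (+-identityʳ _) (*-identityˡ _))
    last : Binomial.binomialTerm commutativeSemiring x y p (fromℕ p) ≡ x ^ p
    last = ≡.trans (≡.cong (λ k → (p C k) · (x ^ k * y ^ (p ℕ.∸ k))) (Fin.toℕ-fromℕ p))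
      (≡.trans (≡.cong₂ (λ k l → k · (x ^ p * y ^ l)) (nCn≡1 p) (ℕ.n∸n≡0 p))
        (≡.trans (+-identityʳ _) (*-identityʳ _)))

  fermat : ∀ x → x ^ p ≡ x
  fermat x = ≡.subst (λ x → x ^ p ≡ x) (Residues.[]-toℕ p x) (go (toℕ x))
    where
    0^ : ∀ {m} → 0 ℕ.< m → 0# ^ m ≡ 0#
    0^ {suc m} _ = zeroˡ (0# ^ m)
    1^ : ∀ m → 1# ^ m ≡ 1#
    1^ zero    = ≡.refl
    1^ (suc m) = ≡.trans (*-identityˡ _) (1^ m)
    go : ∀ m → (m mod p) ^ p ≡ m mod p
    go zero    = 0^ (ℕ.>-nonZero⁻¹ p)
    go (suc m) = ≡.subst (λ x → x ^ p ≡ x) (Residues.[]-+ p 1 m)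
      (≡.trans (frobenius 1# (m mod p)) (≡.cong₂ _+_ (1^ p) (go m)))

module CharacterProperties (p : ℕ) .{{_ : NonZero p}} (prime : Prime p) (K : Field c ℓ) where
  open Field K
  open FieldProperties K
  open 𝔽-Properties p prime using (fermat)
  open VectorEquality setoid using (≋-setoid)
  private
    module 𝔽ₚ = CommutativeRing (𝔽 p)
    module 𝔽^ = Exp 𝔽ₚ.semiring

    0<p-1 : 0 ℕ.< p ℕ.∸ 1
    0<p-1 = ℕ.m<n⇒0<n∸m (ℕ.nonTrivial⇒n>1 p {{prime⇒nonTrivial prime}})

  module _ {χ : Fin p → Carrier} (isCharacter : IsCharacter p K χ) where
    open IsCharacter isCharacter
    open SetoidReasoning setoid

    χ-^ : ∀ x m → χ (x 𝔽^.^ m) ≈ χ x ^ m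
    χ-^ x zero    = χ-1
    χ-^ x (suc m) = trans (χ-* x (x 𝔽^.^ m)) (*-congˡ (χ-^ x m))

    χ-values : ∀ x → χ x ≈ 0# ⊎ χ x ^ (p ℕ.∸ 1) ≈ 1#
    χ-values x with χ x ≟ 0#
    ... | yes χx≈0 = inj₁ χx≈0
    ... | no  χx≉0 = inj₂ (*-cancelʳ χx≉0 (begin
      χ x ^ (p ℕ.∸ 1) * χ x    ≈⟨ *-comm _ _ ⟩
      χ x ^ suc (p ℕ.∸ 1)      ≈⟨ χ-^ x (suc (p ℕ.∸ 1)) ⟨
      χ (x 𝔽^.^ suc (p ℕ.∸ 1)) ≡⟨ ≡.cong (λ m → χ (x 𝔽^.^ m)) (ℕ.m+[n∸m]≡n {1} (ℕ.>-nonZero⁻¹ p)) ⟩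
      χ (x 𝔽^.^ p)             ≡⟨ ≡.cong χ (fermat x) ⟩
      χ x                      ≈⟨ *-identityˡ _ ⟨
      1# * χ x                 ∎))

  module _ {ζ} (charZero : CharacteristicZero) (prim : IsPrimitiveRootOfUnity (p ℕ.∸ 1) ζ) where
    open Membership setoid using (_∈_)
    private
      _∈ᶠ_ : ∀ {n} → (Fin n → Carrier) → List (Fin n → Carrier) → Set _
      _∈ᶠ_ {n} = Membership._∈_ (≋-setoid n)

    values-unique : Unique.Unique setoid (values p K ζ)
    values-unique = All.tabulate⁺ 0≉ζ^ ∷ Unique.tabulate⁺ setoid (ζ-injective charZero prim 0<p-1)
      where
      0≉ζ^ : ∀ i → ¬ 0# ≈ ζ ^ toℕ i
      0≉ζ^ i 0≈ζⁱ = ζ^≉0 charZero prim 0<p-1 (Fin.toℕ<n i) (sym 0≈ζⁱ)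

    functions-unique : ∀ n {vs} → Unique.Unique setoid vs →
                       Unique.Unique (≋-setoid n) (functions p K n vs)
    functions-unique zero    vs! = [] ∷ []
    functions-unique (suc n) vs! = Unique.cartesianProductWith⁺ setoid (≋-setoid n) (≋-setoid (suc n))
      Vector._∷_ (λ eq → eq Fin.zero , λ i → eq (Fin.suc i)) vs! (functions-unique n vs!)

    ∈-functions : ∀ n {vs} (f : Fin n → Carrier) → (∀ i → f i ∈ vs) → f ∈ᶠ functions p K n vs
    ∈-functions zero    f f∈ = here (λ ())
    ∈-functions (suc n) {vs} f f∈ = MembershipProperties.∈-resp-≈ (≋-setoid (suc n))
      (λ { Fin.zero → refl ; (Fin.suc i) → refl })
      (MembershipProperties.∈-cartesianProductWith⁺ setoid (≋-setoid n) (≋-setoid (suc n))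
        (λ { x≈y f≋g Fin.zero → x≈y ; x≈y f≋g (Fin.suc i) → f≋g i })
        (f∈ Fin.zero) (∈-functions n (f ∘ Fin.suc) (f∈ ∘ Fin.suc)))

    characters-unique : Unique.Unique (≋-setoid p) (characters p K ζ)
    characters-unique = Unique.filter⁺ (≋-setoid p) (isCharacter? p K) (functions-unique p values-unique)

    ∈-characters : ∀ {χ} → IsCharacter p K χ → χ ∈ᶠ (characters p K ζ)
    ∈-characters {χ} isCharacter = MembershipProperties.∈-filter⁺ (≋-setoid p) (isCharacter? p K) resp
      (∈-functions p χ value) isCharacter
      where
      resp : ∀ {χ ψ : Fin p → Carrier} → (∀ x → χ x ≈ ψ x) → IsCharacter p K χ → IsCharacter p K ψ
      resp χ≋ψ h = let open IsCharacter h in record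
        { χ-0 = trans (sym (χ≋ψ _)) χ-0
        ; χ-1 = trans (sym (χ≋ψ _)) χ-1
        ; χ-* = λ x y → trans (sym (χ≋ψ _)) (trans (χ-* x y) (*-cong (χ≋ψ x) (χ≋ψ y)))
        }
      value : ∀ x → χ x ∈ values p K ζ
      value x with χ-values isCharacter x
      ... | inj₁ χx≈0 = here χx≈0
      ... | inj₂ χxⁿ≈1 = let i , χx≈ζⁱ = root-of-unity charZero prim 0<p-1 (χ x) χxⁿ≈1 in
        there (MembershipProperties.∈-resp-≈ setoid (sym χx≈ζⁱ) (MembershipProperties.∈-tabulate⁺ setoid i))

{-# OPTIONS --safe #-}

-- Over a point of either projective line the curve is a conic Y² A = T² B,
-- with 1 + φ(A B) points, so its points are counted by the sums of
-- φ((1 - a² x²)(a² - x²)).  Substituting x² = a² y turns these into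
-- Σ φ(y (1 - y)(1 - μ y)), where μ = a⁴, plus the sum of φ((1 - y)(1 - μ y)),
-- which is -1.  On the other side the squares of the binomial coefficients in
-- the series at 1 - μ are double sums over y and z, and the sum over χ forces
-- y z (1 - μ) = (1 - y)(1 - z), so that z (1 - μ y) = 1 - y: again
-- Σ φ(y (1 - y)(1 - μ y)).  Orthogonality of the characters needs a primitive
-- root g modulo p, which also gives φ(gⁱ) = (-1)ⁱ.

module Submission where

open import Defs
open import Algebra.Bundles using (CommutativeRing; Semiring)
open import Algebra.Core using (Op₁; Op₂)
import Algebra.Properties.CommutativeSemigroup as CommutativeSemigroupProperties
import Algebra.Properties.CommutativeSemiring.Binomial as Binomial
import Algebra.Properties.CommutativeSemiring.Exp as CommutativeExp
import Algebra.Properties.Ring as RingProperties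
import Algebra.Properties.Semiring.Exp as Exp
import Algebra.Properties.Semiring.Mult as Mult
import Algebra.Properties.Semiring.Mult.TCOptimised as OptimisedMult
import Algebra.Properties.Semiring.Sum as Sum
import Algebra.Solver.Ring as RingSolver
open import Algebra.Solver.Ring.AlmostCommutativeRing using (fromCommutativeRing; _-Raw-AlmostCommutative⟶_)
open import Algebra.Structures using (IsCommutativeRing)
open import Data.Empty using (⊥-elim)
open import Data.Fin.Base as Fin using (Fin; toℕ; fromℕ; inject₁; punchIn)
open import Data.Fin.Permutation using (Permutation; permutation)
import Data.Fin.Properties as Fin
open import Data.Integer.Base as ℤ using (ℤ; -[1+_]; _⊖_)
import Data.Integer.Properties as ℤ
open import Data.List.Base using (List; []; _∷_; length; map; filter; allFin; tabulate; cartesianProduct; _++_; lookup)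
import Data.List.Membership.Propositional.Properties as Membership
open import Data.List.Relation.Unary.All as All using (All; []; _∷_)
import Data.List.Relation.Unary.All.Properties as All
open import Data.List.Relation.Unary.AllPairs using (_∷_)
import Data.List.Relation.Unary.Any as Any
import Data.List.Relation.Unary.Any.Properties as Any
open import Data.List.Relation.Unary.Unique.Setoid using (Unique)
open import Data.Maybe.Base as Maybe using ()
open import Data.Nat.Base as ℕ using (ℕ; zero; suc; NonZero; z≤n; s≤s; _∸_)
open import Data.Nat.Combinatorics using (_C_; nCn≡1; nC1≡n; nCk≡nC[n∸k])
open import Data.Nat.Coprimality as Coprime using (Coprime)
open import Data.Nat.DivMod using (_%_; m<n⇒m%n≡m)
open import Data.Nat.Divisibility using (_∣_; _∤_; _∣?_; divides; ∣⇒≤; m%n≡0⇒n∣m; *-monoˡ-∣)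
open import Data.Nat.GCD using (module Bézout)
open import Data.Nat.Induction using (<-rec)
open import Data.Nat.ListAction using (product)
open import Data.Nat.Primality using (Prime; euclidsLemma; prime⇒nonTrivial; prime⇒irreducible)
open import Data.Nat.Primality.Factorisation using (factorise; module PrimeFactorisation)
import Data.Nat.Properties as ℕ
open import Data.Product.Base using (_×_; _,_; ∃; proj₁; proj₂; uncurry)
import Data.Sign.Base as Sign
open import Data.Sum.Base using (_⊎_; inj₁; inj₂)
import Data.Vec.Functional as Vector
import Data.Vec.Functional.Relation.Binary.Equality.Setoid as VectorEquality
open import Function.Base using (_∘_)
open import Function.Bundles using (_⇔_; mk⇔; Equivalence)
open import Function.Definitions using (Injective)
open import Level using (Level)
open import Relation.Binary.Bundles using (Setoid)
open import Relation.Binary.PropositionalEquality as ≡ using (_≡_; _≢_)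
import Relation.Binary.Reasoning.Setoid as SetoidReasoning
open import Relation.Nullary.Decidable using (Dec; yes; no; dec⇒maybe; _×-dec_; ¬?; decidable-stable)
open import Relation.Nullary.Negation using (¬_; contradiction)
open import Relation.Unary using (Pred; Decidable)

-- The listed characters are known only as a complete family, without repetition, of functions into
-- an abstract field. Neither their number nor their group structure can be read off; the character
-- `g ↦ ζ` supplies what is needed of both, and this is what the primitive root is for. The
-- existence of `g` is drawn from one fact about 𝔽ₚ: the sum of `x ^ k` over all `x` vanishes for
-- `k < p - 1`. It yields q-th roots as well as elements with `x ^ j ≠ 1`, and from these elements
-- of growing order. The hypothesis `a ^ 5 ≠ a` says that `a ≠ 0` and `μ ≠ 1`. So no fibre fills the
-- whole projective line, and the fibre over (1 : 0) has exactly two points, one of which is offset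
-- by the sum -1; the other is the 1 of the formula. Both sides are compared in `K`, where
-- characteristic zero makes `p` and `p - 1` invertible. The convention 0⁻¹ = 0 keeps substitutions
-- with a pole total.

private variable
  c ℓ : Level

-- Polynomial identities with integer coefficients

module IntegerSolver (R : CommutativeRing c ℓ) where
  open CommutativeRing R
  open RingProperties ring
  open OptimisedMult semiring using (×-homo-+; ×1-homo-*; 1+×) renaming (_×_ to _·_)
  open SetoidReasoning setoid

  -- With the optimised multiple, `1 · 1#` reduces to `1#`. The constant `con ℤ.1ℤ` of a solver goal
  -- therefore denotes `1#` itself.
  ⟦_⟧ℤ : ℤ → Carrier
  ⟦ ℤ.+ n ⟧ℤ    = n · 1#
  ⟦ -[1+ n ] ⟧ℤ = - (suc n · 1#)

  ⊖-homo : ∀ m n → ⟦ m ⊖ n ⟧ℤ ≈ m · 1# - n · 1#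
  ⊖-homo zero    zero    = sym (-‿inverseʳ 0#)
  ⊖-homo (suc m) zero    = sym (trans (+-congˡ -0#≈0#) (+-identityʳ _))
  ⊖-homo zero    (suc n) = sym (+-identityˡ _)
  ⊖-homo (suc m) (suc n) = begin
    ⟦ suc m ⊖ suc n ⟧ℤ                       ≡⟨ ≡.cong ⟦_⟧ℤ (ℤ.[1+m]⊖[1+n]≡m⊖n m n) ⟩
    ⟦ m ⊖ n ⟧ℤ                               ≈⟨ ⊖-homo m n ⟩
    m · 1# - n · 1#                          ≈⟨ +-congʳ (xyx⁻¹≈y 1# (m · 1#)) ⟨
    (1# + m · 1#) + - 1# - n · 1#            ≈⟨ +-assoc _ _ _ ⟩
    (1# + m · 1#) + (- 1# - n · 1#)          ≈⟨ +-congˡ (-‿+-comm 1# (n · 1#)) ⟩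
    (1# + m · 1#) - (1# + n · 1#)            ≈⟨ +-cong (1+× m 1#) (-‿cong (1+× n 1#)) ⟨
    suc m · 1# - suc n · 1#                  ∎

  +-homo : ∀ i j → ⟦ i ℤ.+ j ⟧ℤ ≈ ⟦ i ⟧ℤ + ⟦ j ⟧ℤ
  +-homo (ℤ.+ m)  (ℤ.+ n)  = ×-homo-+ 1# m n
  +-homo (ℤ.+ m)  -[1+ n ] = ⊖-homo m (suc n)
  +-homo -[1+ m ] (ℤ.+ n)  = trans (⊖-homo n (suc m)) (+-comm _ _)
  +-homo -[1+ m ] -[1+ n ] = begin
    - (suc (suc (m ℕ.+ n)) · 1#)       ≡⟨ ≡.cong (λ k → - (suc k · 1#)) (≡.sym (ℕ.+-suc m n)) ⟩
    - ((suc m ℕ.+ suc n) · 1#)         ≈⟨ -‿cong (×-homo-+ 1# (suc m) (suc n)) ⟩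
    - (suc m · 1# + suc n · 1#)        ≈⟨ -‿+-comm _ _ ⟨
    - (suc m · 1#) - (suc n · 1#)      ∎

  -‿homo : ∀ i → ⟦ ℤ.- i ⟧ℤ ≈ - ⟦ i ⟧ℤ
  -‿homo (ℤ.+ zero)  = sym -0#≈0#
  -‿homo (ℤ.+ suc n) = refl
  -‿homo -[1+ n ]    = sym (-‿involutive _)

  *-homo : ∀ i j → ⟦ i ℤ.* j ⟧ℤ ≈ ⟦ i ⟧ℤ * ⟦ j ⟧ℤ
  *-homo (ℤ.+ m)  (ℤ.+ n)  = trans (reflexive (≡.cong ⟦_⟧ℤ (ℤ.+◃n≡+n (m ℕ.* n)))) (×1-homo-* m n)
  *-homo (ℤ.+ m)  -[1+ n ] = begin
    ⟦ Sign.- ℤ.◃ (m ℕ.* suc n) ⟧ℤ ≡⟨ ≡.cong ⟦_⟧ℤ (ℤ.-◃n≡-n (m ℕ.* suc n)) ⟩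
    ⟦ ℤ.- (ℤ.+ (m ℕ.* suc n)) ⟧ℤ  ≈⟨ -‿homo (ℤ.+ (m ℕ.* suc n)) ⟩
    - ((m ℕ.* suc n) · 1#)        ≈⟨ -‿cong (×1-homo-* m (suc n)) ⟩
    - (m · 1# * suc n · 1#)       ≈⟨ -‿distribʳ-* _ _ ⟩
    m · 1# * - (suc n · 1#)       ∎
  *-homo -[1+ m ] (ℤ.+ n)  = begin
    ⟦ Sign.- ℤ.◃ (suc m ℕ.* n) ⟧ℤ ≡⟨ ≡.cong ⟦_⟧ℤ (ℤ.-◃n≡-n (suc m ℕ.* n)) ⟩
    ⟦ ℤ.- (ℤ.+ (suc m ℕ.* n)) ⟧ℤ  ≈⟨ -‿homo (ℤ.+ (suc m ℕ.* n)) ⟩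
    - ((suc m ℕ.* n) · 1#)        ≈⟨ -‿cong (×1-homo-* (suc m) n) ⟩
    - (suc m · 1# * n · 1#)       ≈⟨ -‿distribˡ-* _ _ ⟩
    - (suc m · 1#) * n · 1#       ∎
  *-homo -[1+ m ] -[1+ n ] = begin
    (suc m ℕ.* suc n) · 1#            ≈⟨ ×1-homo-* (suc m) (suc n) ⟩
    suc m · 1# * suc n · 1#           ≈⟨ -‿involutive _ ⟨
    - - (suc m · 1# * suc n · 1#)     ≈⟨ -‿cong (-‿distribˡ-* _ _) ⟩
    - (- (suc m · 1#) * suc n · 1#)   ≈⟨ -‿distribʳ-* _ _ ⟩
    - (suc m · 1#) * - (suc n · 1#)   ∎

  morphism : ℤ.+-*-rawRing -Raw-AlmostCommutative⟶ fromCommutativeRing R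
  morphism = record
    { ⟦_⟧    = ⟦_⟧ℤ
    ; +-homo = +-homo
    ; *-homo = *-homo
    ; -‿homo = -‿homo
    ; 0-homo = refl
    ; 1-homo = refl
    }

  open RingSolver ℤ.+-*-rawRing (fromCommutativeRing R) morphism
    (λ i j → Maybe.map (λ i≡j → reflexive (≡.cong ⟦_⟧ℤ i≡j)) (dec⇒maybe (i ℤ.≟ j)))
    public using (Polynomial; solve; _:=_; _:+_; _:*_; _:-_; :-_; _:^_; con)

-- Finite sets and finite sums

injective⇒surjective : ∀ {m n} → n ℕ.≤ m → {f : Fin m → Fin n} → Injective _≡_ _≡_ f → ∀ y → ∃ λ x → f x ≡ y
injective⇒surjective {m} {n} n≤m {f} f-inj y with Fin.any? (λ x → f x Fin.≟ y)
... | yes found = found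
-- Prepending the missed value `y` to `f` would inject `suc m` elements into `n ≤ m`.
... | no  none  = ⊥-elim (Fin.<⇒notInjective (s≤s n≤m) g-inj)
  where
  g : Fin (suc m) → Fin n
  g Fin.zero    = y
  g (Fin.suc x) = f x
  g-inj : Injective _≡_ _≡_ g
  g-inj {Fin.zero}  {Fin.zero}  _  = ≡.refl
  g-inj {Fin.zero}  {Fin.suc x} eq = contradiction (x , ≡.sym eq) none
  g-inj {Fin.suc x} {Fin.zero}  eq = contradiction (x , eq) none
  g-inj {Fin.suc x} {Fin.suc z} eq = ≡.cong Fin.suc (f-inj eq)

injective⇒permutation : ∀ {n} (f : Fin n → Fin n) → Injective _≡_ _≡_ f → Permutation n n
injective⇒permutation f f-inj = permutation f f⁻¹ (λ y → ff⁻¹ y) (λ x → f-inj (ff⁻¹ (f x)))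
  where
  f⁻¹  = λ y → proj₁ (injective⇒surjective ℕ.≤-refl f-inj y)
  ff⁻¹ = λ y → proj₂ (injective⇒surjective ℕ.≤-refl f-inj y)

module FiniteSums (R : Semiring c ℓ) where
  open Semiring R
  open Sum R
  open SetoidReasoning setoid
  private variable
    α β : Level
    A : Set α
    B : Set β
    n : ℕ

  sum-reindex : (f : Fin n → Carrier) {π : Fin n → Fin n} → Injective _≡_ _≡_ π →
                sum (f ∘ π) ≈ sum f
  sum-reindex f {π} π-inj = sym (sum-permute f (injective⇒permutation π π-inj))

  sum-zero : {f : Fin n → Carrier} → (∀ i → f i ≈ 0#) → sum f ≈ 0#
  sum-zero {n} f≈0 = trans (sum-cong-≋ f≈0) (sum-replicate-zero n)

  sum-single : (f : Fin n → Carrier) (i : Fin n) → (∀ j → j ≢ i → f j ≈ 0#) → sum f ≈ f i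
  sum-single {suc n} f i f≈0 = begin
    sum f                              ≈⟨ sum-remove f ⟩
    f i + sum (Vector.removeAt f i)    ≈⟨ +-congˡ (sum-zero (λ j → f≈0 (punchIn i j) (Fin.punchInᵢ≢i i j))) ⟩
    f i + 0#                           ≈⟨ +-identityʳ (f i) ⟩
    f i                                ∎

  -- The Iverson bracket. Counting inside the semiring lets point counts and character sums be added
  -- to each other.
  ⟦_⟧ : Dec A → Carrier
  ⟦ yes _ ⟧ = 1#
  ⟦ no  _ ⟧ = 0#

  ⟦⟧-yes : (A? : Dec A) → A → ⟦ A? ⟧ ≈ 1#
  ⟦⟧-yes (yes _) _ = refl
  ⟦⟧-yes (no ¬A) A = contradiction A ¬A

  ⟦⟧-no : (A? : Dec A) → ¬ A → ⟦ A? ⟧ ≈ 0#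
  ⟦⟧-no (yes A) ¬A = contradiction A ¬A
  ⟦⟧-no (no _)  _  = refl

  ⟦⟧-cong : (A? : Dec A) (B? : Dec B) → (A → B) → (B → A) → ⟦ A? ⟧ ≈ ⟦ B? ⟧
  ⟦⟧-cong (yes A) B? f g = sym (⟦⟧-yes B? (f A))
  ⟦⟧-cong (no ¬A) B? f g = sym (⟦⟧-no B? (¬A ∘ g))

  -- The sifting property of the Kronecker delta. With `f` constantly 1 it also serves to correct a
  -- summand at a single point.
  sum-⟦≟⟧ : (f : Fin n → Carrier) (i : Fin n) → sum (λ j → f j * ⟦ i Fin.≟ j ⟧) ≈ f i
  sum-⟦≟⟧ f i = begin
    sum (λ j → f j * ⟦ i Fin.≟ j ⟧)
      ≈⟨ sum-single _ i (λ j j≢i → trans (*-congˡ (⟦⟧-no (i Fin.≟ j) (j≢i ∘ ≡.sym))) (zeroʳ _)) ⟩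
    f i * ⟦ i Fin.≟ i ⟧    ≈⟨ *-congˡ (⟦⟧-yes (i Fin.≟ i) ≡.refl) ⟩
    f i * 1#               ≈⟨ *-identityʳ (f i) ⟩
    f i                    ∎

-- The prime field

-- Arithmetic in 𝔽 p unfolds to arithmetic on representatives, which defeats
-- unification; a variable of this type has opaque operations instead.
record PrimeField (p : ℕ) : Set where
  field
    {_+_} {_*_}       : Op₂ (Fin p)
    { -_ }            : Op₁ (Fin p)
    {0#} {1#}         : Fin p
    isCommutativeRing : IsCommutativeRing _≡_ _+_ _*_ -_ 0# 1#

  commutativeRing : CommutativeRing _ _
  commutativeRing = record { isCommutativeRing = isCommutativeRing }

  open CommutativeRing commutativeRing using (semiring)
  open Exp semiring using (_^_)
  open Mult semiring using () renaming (_×_ to _·_)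

  field
    1<p       : 1 ℕ.< p
    1≉0       : 1# ≢ 0#
    inverse   : ∀ x → x ≢ 0# → ∃ λ y → x * y ≡ 1#
    ·-zero    : ∀ {m} x → 0 ℕ.< m → m ℕ.< p → m · x ≡ 0# → x ≡ 0#
    x^[p-1]≡1 : ∀ {x} → x ≢ 0# → x ^ (p ℕ.∸ 1) ≡ 1#

  field𝔽 : Field _ _
  field𝔽 = record
    { commutativeRing = commutativeRing
    ; 1≉0     = 1≉0
    ; _≟_     = Fin._≟_
    ; inverse = inverse
    }

module ResidueField (p : ℕ) .{{_ : NonZero p}} (prime : Prime p) where
  private module R = CommutativeRing (𝔽 p)
  open Residues p using ([_]; toℕ-[]; []-toℕ)
  open 𝔽-Properties p prime using (fermat; ·-mod)
  open Exp R.semiring using (_^_)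
  open Mult R.semiring using () renaming (_×_ to _·_)
  open ≡.≡-Reasoning

  1<p : 1 ℕ.< p
  1<p = ℕ.nonTrivial⇒n>1 p {{prime⇒nonTrivial prime}}

  toℕ≡0⇒≡0 : ∀ {x : Fin p} → p ∣ toℕ x → x ≡ R.0#
  toℕ≡0⇒≡0 {x} p∣x with toℕ x in eq
  ... | zero  = ≡.trans (≡.sym ([]-toℕ x)) (≡.cong [_] eq)
  ... | suc m = contradiction (≡.subst (ℕ._< p) eq (Fin.toℕ<n x)) (ℕ.≤⇒≯ (∣⇒≤ p∣x))

  mod≡0⇒∣ : ∀ {m} → [ m ] ≡ R.0# → p ∣ m
  mod≡0⇒∣ {m} eq = m%n≡0⇒n∣m m p (begin
    m % p       ≡⟨ toℕ-[] m ⟨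
    toℕ [ m ]   ≡⟨ ≡.cong toℕ eq ⟩
    toℕ [ 0 ]   ≡⟨ toℕ-[] 0 ⟩
    0 % p       ≡⟨ m<n⇒m%n≡m (ℕ.>-nonZero⁻¹ p) ⟩
    0           ∎)

  zero-product : ∀ x y → x R.* y ≡ R.0# → x ≡ R.0# ⊎ y ≡ R.0#
  zero-product x y eq with euclidsLemma (toℕ x) (toℕ y) prime (mod≡0⇒∣ eq)
  ... | inj₁ p∣x = inj₁ (toℕ≡0⇒≡0 p∣x)
  ... | inj₂ p∣y = inj₂ (toℕ≡0⇒≡0 p∣y)

  ·-zero : ∀ {m} x → 0 ℕ.< m → m ℕ.< p → m · x ≡ R.0# → x ≡ R.0#
  ·-zero {suc m} x _ m<p eq with euclidsLemma (suc m) (toℕ x) prime (mod≡0⇒∣ (≡.trans (≡.sym (·-mod (suc m) x)) eq))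
  ... | inj₁ p∣m = contradiction m<p (ℕ.≤⇒≯ (∣⇒≤ p∣m))
  ... | inj₂ p∣x = toℕ≡0⇒≡0 p∣x

  x^[p-1]≡1 : ∀ {x} → x ≢ R.0# → x ^ (p ℕ.∸ 1) ≡ R.1#
  x^[p-1]≡1 {x} x≢0 with zero-product x (x ^ (p ℕ.∸ 1) R.- R.1#) (begin
    x R.* (x ^ (p ℕ.∸ 1) R.- R.1#)           ≡⟨ RingProperties.x[y-z]≈xy-xz R.ring x _ _ ⟩
    x ^ suc (p ℕ.∸ 1) R.- x R.* R.1#         ≡⟨ ≡.cong₂ R._-_ (≡.cong (x ^_) (ℕ.m+[n∸m]≡n {1} (ℕ.>-nonZero⁻¹ p))) (R.*-identityʳ x) ⟩
    x ^ p R.- x                              ≡⟨ ≡.cong (R._- x) (fermat x) ⟩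
    x R.- x                                  ≡⟨ R.-‿inverseʳ x ⟩
    R.0#                                     ∎)
  ... | inj₁ x≡0 = contradiction x≡0 x≢0
  ... | inj₂ eq  = RingProperties.x∙y⁻¹≈ε⇒x≈y R.ring _ _ eq

  primeField : PrimeField p
  primeField = record
    { isCommutativeRing = R.isCommutativeRing
    ; 1<p       = 1<p
    ; 1≉0       = λ 1≡0 → contradiction 1<p (ℕ.≤⇒≯ (∣⇒≤ (mod≡0⇒∣ 1≡0)))
    ; inverse   = λ x x≢0 → x ^ (p ℕ.∸ 2) , ≡.trans (≡.cong (x ^_) (≡.sym (ℕ.+-∸-assoc 1 1<p))) (x^[p-1]≡1 x≢0)
    ; ·-zero    = ·-zero
    ; x^[p-1]≡1 = x^[p-1]≡1
    }

-- Power sums over the prime field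

module PowerSums {p} (𝔽ₚ : PrimeField p) where
  open PrimeField 𝔽ₚ using (field𝔽; 1<p; ·-zero)
  open Field field𝔽
  open RingProperties ring using (+-cancelʳ)
  open FiniteSums semiring
  open Sum semiring
  open ≡.≡-Reasoning

  N : ℕ
  N = p ℕ.∸ 1

  1+N≡p : suc N ≡ p
  1+N≡p = ℕ.m+[n∸m]≡n {1} (ℕ.<⇒≤ 1<p)

  S : ℕ → Carrier
  S k = sum (λ (x : Fin p) → x ^ k)

  ·-sum : ∀ {n} m (f : Fin n → Carrier) → sum (λ i → m · f i) ≡ m · sum f
  ·-sum zero    f = sum-zero {f = λ i → 0 · f i} (λ _ → ≡.refl)
  ·-sum (suc m) f = ≡.trans (∑-distrib-+ f _) (≡.cong (sum f +_) (·-sum m f))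

  1^ : ∀ m → 1# ^ m ≡ 1#
  1^ zero    = ≡.refl
  1^ (suc m) = ≡.trans (*-identityˡ _) (1^ m)

  -- The translation by 1 permutes the field, and the binomial theorem expands each `(x + 1#) ^ k`.
  sum-powers : ∀ k → S k ≡ sum {suc k} (λ i → (k C toℕ i) · S (toℕ i))
  sum-powers k = begin
    sum (λ x → x ^ k)          ≡⟨ sum-reindex (_^ k) {_+ 1#} (λ {x} {y} → +-cancelʳ 1# x y) ⟨
    sum (λ x → (x + 1#) ^ k)   ≡⟨ sum-cong-≋ (λ x → Binomial.theorem commutativeSemiring k x 1#) ⟩
    sum {p} (λ x → sum {suc k} (λ i → (k C toℕ i) · (x ^ toℕ i * 1# ^ (k ℕ.∸ toℕ i))))
      ≡⟨ ∑-comm {p} {suc k} (λ x i → (k C toℕ i) · (x ^ toℕ i * 1# ^ (k ℕ.∸ toℕ i))) ⟩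
    sum {suc k} (λ i → sum {p} (λ x → (k C toℕ i) · (x ^ toℕ i * 1# ^ (k ℕ.∸ toℕ i))))
      ≡⟨ sum-cong-≋ {suc k} (λ i → ≡.trans (sum-cong-≋ {p} (λ x → ≡.cong ((k C toℕ i) ·_)
           (≡.trans (≡.cong (x ^ toℕ i *_) (1^ (k ℕ.∸ toℕ i))) (*-identityʳ (x ^ toℕ i)))))
           (·-sum {p} (k C toℕ i) (_^ toℕ i))) ⟩
    sum {suc k} (λ i → (k C toℕ i) · S (toℕ i)) ∎

  [1+k]Ck≡1+k : ∀ k → suc k C k ≡ suc k
  [1+k]Ck≡1+k k = ≡.trans (nCk≡nC[n∸k] (ℕ.n≤1+n k))
    (≡.trans (≡.cong (suc k C_) (ℕ.m+n∸n≡m 1 k)) (nC1≡n (suc k)))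

  -- Comparing the two sides of sum-powers for k + 1 leaves (k + 1) S k = 0.
  S≡0 : ∀ k → k ℕ.< N → S k ≡ 0#
  S≡0 = <-rec _ step
    where
    step : ∀ k → (∀ {j} → j ℕ.< k → j ℕ.< N → S j ≡ 0#) → k ℕ.< N → S k ≡ 0#
    -- The bound on `k` enters here: `suc k` lies strictly between 0 and `p`, so it can be cancelled
    -- as a scalar.
    step k rec k<N = ·-zero {suc k} (S k) (s≤s z≤n) (≡.subst (suc k ℕ.<_) 1+N≡p (s≤s k<N)) (+-cancelʳ (S (suc k)) _ _ (begin
      suc k · S k + S (suc k)
        ≡⟨ ≡.cong₂ _+_ inits last ⟨
      sum (λ i → t (inject₁ i)) + t (fromℕ (suc k)) ≡⟨ sum-init-last t ⟨
      sum t                              ≡⟨ sum-powers (suc k) ⟨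
      S (suc k)                          ≡⟨ +-identityˡ _ ⟨
      0# + S (suc k)                     ∎))
      where
      t : Fin (suc (suc k)) → Carrier
      t i = (suc k C toℕ i) · S (toℕ i)
      t-at : ∀ i {m} → toℕ i ≡ m → t i ≡ (suc k C m) · S m
      t-at i ≡.refl = ≡.refl
      last : t (fromℕ (suc k)) ≡ S (suc k)
      last = ≡.trans (t-at _ (Fin.toℕ-fromℕ (suc k))) (≡.trans (≡.cong (_· S (suc k)) (nCn≡1 (suc k))) (+-identityʳ _))
      inits : sum (λ i → t (inject₁ i)) ≡ suc k · S k
      inits = begin
        sum (λ i → t (inject₁ i))    ≡⟨ sum-init-last (λ i → t (inject₁ i)) ⟩
        sum (λ i → t (inject₁ (inject₁ i))) + t (inject₁ (fromℕ k))
          ≡⟨ ≡.cong₂ _+_ (sum-zero {k} {λ i → t (inject₁ (inject₁ i))} small)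
               (t-at _ (≡.trans (Fin.toℕ-inject₁ (fromℕ k)) (Fin.toℕ-fromℕ k))) ⟩
        0# + (suc k C k) · S k        ≡⟨ +-identityˡ _ ⟩
        (suc k C k) · S k             ≡⟨ ≡.cong (_· S k) ([1+k]Ck≡1+k k) ⟩
        suc k · S k                   ∎
        where
        small : ∀ (i : Fin k) → t (inject₁ (inject₁ i)) ≡ 0#
        small i = ≡.trans (t-at (inject₁ (inject₁ i)) (≡.trans (Fin.toℕ-inject₁ (inject₁ i)) (Fin.toℕ-inject₁ i)))
          (≡.trans (≡.cong ((suc k C toℕ i) ·_) (rec (Fin.toℕ<n i) (ℕ.<-trans (Fin.toℕ<n i) k<N))) (·0 (suc k C toℕ i)))
          where
          ·0 : ∀ m → m · 0# ≡ 0#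
          ·0 zero    = ≡.refl
          ·0 (suc m) = ≡.trans (+-identityˡ _) (·0 m)

-- Existence of a primitive root

module PrimitiveRoot {p} (𝔽ₚ : PrimeField p) where
  open PrimeField 𝔽ₚ using (field𝔽; 1<p; x^[p-1]≡1)
  open PowerSums 𝔽ₚ
  open Field field𝔽
  open FieldProperties field𝔽 using (*-cancelʳ)
  open RingProperties ring using (+-cancelʳ)
  open FiniteSums semiring
  open Sum semiring
  open Exp semiring using (^-assocʳ)
  open CommutativeExp commutativeSemiring using (^-distrib-*)
  open ≡.≡-Reasoning

  0<N : 0 ℕ.< N
  0<N = ℕ.m<n⇒0<n∸m 1<p

  -- The geometric series in a form free of division, valid for every `z`: for `z ^ m = 1` it leads
  -- to `geometric`, and at `z = 0` it gives the value 1 that `root` contradicts.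
  telescope : ∀ z m → z * sum {m} (λ i → z ^ toℕ i) + 1# ≡ sum {m} (λ i → z ^ toℕ i) + z ^ m
  telescope z zero    = ≡.cong (_+ 1#) (zeroʳ z)
  telescope z (suc m) = begin
    z * sum {suc m} (λ i → z ^ toℕ i) + 1#     ≡⟨ +-comm _ _ ⟩
    1# + z * sum {suc m} (λ i → z ^ toℕ i)     ≡⟨ ≡.cong (λ s → 1# + z * s) shift ⟩
    1# + z * (G + z ^ m)                       ≡⟨ ≡.cong (1# +_) (distribˡ z G (z ^ m)) ⟩
    1# + (z * G + z ^ suc m)                   ≡⟨ +-assoc _ _ _ ⟨
    1# + z * G + z ^ suc m                     ≡⟨ ≡.cong (λ s → 1# + s + z ^ suc m) (*-distribˡ-sum {m} z (λ i → z ^ toℕ i)) ⟩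
    sum {suc m} (λ i → z ^ toℕ i) + z ^ suc m  ∎
    where
    G = sum {m} (λ i → z ^ toℕ i)
    shift : sum {suc m} (λ i → z ^ toℕ i) ≡ G + z ^ m
    shift = ≡.trans (≡.cong (1# +_) (≡.sym (*-distribˡ-sum {m} z (λ i → z ^ toℕ i))))
      (≡.trans (+-comm 1# (z * G)) (telescope z m))

  geometric : ∀ z m → z ^ m ≡ 1# → z ≢ 1# → sum {m} (λ i → z ^ toℕ i) ≡ 0#
  geometric z m zᵐ≡1 z≢1 = decidable-stable (G ≟ 0#) (λ G≢0 → z≢1 (*-cancelʳ G≢0 (begin
    z * G     ≡⟨ +-cancelʳ 1# _ _ (≡.trans (telescope z m) (≡.cong (G +_) zᵐ≡1)) ⟩
    G         ≡⟨ *-identityˡ G ⟨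
    1# * G    ∎)))
    where G = sum {m} (λ i → z ^ toℕ i)

  0^ : ∀ {m} → 0 ℕ.< m → 0# ^ m ≡ 0#
  0^ {suc m} _ = zeroˡ (0# ^ m)

  -- Otherwise Σₓ Σᵢ (h x^q)ⁱ is 1 when summed over i first, and 0 when
  -- summed over x first.
  root : ∀ {h} q M → 0 ℕ.< q → 0 ℕ.< M → M ℕ.* q ≡ N → h ^ M ≡ 1# → ∃ λ k → k ^ q ≡ h
  root {h} q M 0<q 0<M Mq≡N hᴹ≡1 with Fin.any? (λ x → h * x ^ q ≟ 1#)
  -- The inverse of `x` is the root sought.
  ... | yes (x , hx^q≡1) = y , (begin
    y ^ q                  ≡⟨ *-identityˡ _ ⟨
    1# * y ^ q             ≡⟨ ≡.cong (_* y ^ q) hx^q≡1 ⟨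
    h * x ^ q * y ^ q      ≡⟨ *-assoc _ _ _ ⟩
    h * (x ^ q * y ^ q)    ≡⟨ ≡.cong (h *_) (^-distrib-* x y q) ⟨
    h * (x * y) ^ q        ≡⟨ ≡.cong (λ z → h * z ^ q) (proj₂ (inverse x x≢0)) ⟩
    h * 1# ^ q             ≡⟨ ≡.cong (h *_) (1^ q) ⟩
    h * 1#                 ≡⟨ *-identityʳ h ⟩
    h                      ∎)
    where
    x≢0 : x ≢ 0#
    x≢0 ≡.refl = 1≉0 (≡.trans (≡.sym hx^q≡1) (≡.trans (≡.cong (h *_) (0^ 0<q)) (zeroʳ h)))
    y = proj₁ (inverse x x≢0)
  ... | no none = contradiction (begin
    1#                                                          ≡⟨ 0-row ⟨
    sum {M} (λ i → z 0# ^ toℕ i)                                ≡⟨ sum-single {p} (λ x → sum {M} (λ i → z x ^ toℕ i)) 0# (λ x x≢0 → geometric (z x) M (zᴹ≡1 x≢0) (λ eq → none (x , eq))) ⟨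
    sum {p} (λ x → sum {M} (λ i → z x ^ toℕ i))                 ≡⟨ ∑-comm {p} {M} (λ x i → z x ^ toℕ i) ⟩
    sum {M} (λ i → sum {p} (λ x → z x ^ toℕ i))                 ≡⟨ sum-zero {f = λ (i : Fin M) → sum {p} (λ x → z x ^ toℕ i)} column ⟩
    0#                                                          ∎) 1≉0
    where
    z : Carrier → Carrier
    z x = h * x ^ q
    zᴹ≡1 : ∀ {x} → x ≢ 0# → z x ^ M ≡ 1#
    zᴹ≡1 {x} x≢0 = begin
      (h * x ^ q) ^ M        ≡⟨ ^-distrib-* h (x ^ q) M ⟩
      h ^ M * (x ^ q) ^ M    ≡⟨ ≡.cong₂ _*_ hᴹ≡1 (^-assocʳ x q M) ⟩
      1# * x ^ (q ℕ.* M)     ≡⟨ *-identityˡ _ ⟩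
      x ^ (q ℕ.* M)          ≡⟨ ≡.cong (x ^_) (≡.trans (ℕ.*-comm q M) Mq≡N) ⟩
      x ^ N                  ≡⟨ x^[p-1]≡1 x≢0 ⟩
      1#                     ∎
    z0≡0 : z 0# ≡ 0#
    z0≡0 = ≡.trans (≡.cong (h *_) (0^ 0<q)) (zeroʳ h)
    0-row : sum {M} (λ i → z 0# ^ toℕ i) ≡ 1#
    0-row = begin
      G                ≡⟨ +-identityʳ G ⟨
      G + 0#           ≡⟨ ≡.cong (G +_) (≡.trans (≡.cong (_^ M) z0≡0) (0^ 0<M)) ⟨
      G + z 0# ^ M     ≡⟨ telescope (z 0#) M ⟨
      z 0# * G + 1#    ≡⟨ ≡.cong (λ u → u * G + 1#) z0≡0 ⟩
      0# * G + 1#      ≡⟨ ≡.cong (_+ 1#) (zeroˡ G) ⟩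
      0# + 1#          ≡⟨ +-identityˡ 1# ⟩
      1#               ∎
      where G = sum {M} (λ i → z 0# ^ toℕ i)
    column : ∀ (i : Fin M) → sum {p} (λ x → z x ^ toℕ i) ≡ 0#
    column i = begin
      sum {p} (λ x → z x ^ toℕ i)
        ≡⟨ sum-cong-≋ {p} (λ x → ≡.trans (^-distrib-* h (x ^ q) (toℕ i)) (≡.cong (h ^ toℕ i *_) (^-assocʳ x q (toℕ i)))) ⟩
      sum {p} (λ x → h ^ toℕ i * x ^ (q ℕ.* toℕ i))
        ≡⟨ *-distribˡ-sum {p} (h ^ toℕ i) (_^ (q ℕ.* toℕ i)) ⟨
      h ^ toℕ i * S (q ℕ.* toℕ i)
        ≡⟨ ≡.cong (h ^ toℕ i *_) (S≡0 (q ℕ.* toℕ i) qi<N) ⟩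
      h ^ toℕ i * 0#     ≡⟨ zeroʳ _ ⟩
      0#                 ∎
      where
      qi<N : q ℕ.* toℕ i ℕ.< N
      qi<N = ≡.subst (q ℕ.* toℕ i ℕ.<_) (≡.trans (ℕ.*-comm q M) Mq≡N)
        (ℕ.*-monoʳ-< q {{ℕ.>-nonZero 0<q}} (Fin.toℕ<n i))

  -- Otherwise `x ^ j` plus the indicator of `x = 0` would be 1 for all `x`. Summing gives
  -- `S j + 1 = S 0`, although both power sums vanish.
  nonRoot : ∀ {j} → 0 ℕ.< j → j ℕ.< N → ∃ λ x → x ≢ 0# × x ^ j ≢ 1#
  nonRoot {j} 0<j j<N with Fin.any? (λ x → ¬? (x ≟ 0#) ×-dec ¬? (x ^ j ≟ 1#))
  ... | yes found = found
  ... | no  none  = contradiction (begin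
    1#                                           ≡⟨ sum-⟦≟⟧ (λ _ → 1#) 0# ⟨
    sum (λ x → 1# * ⟦ 0# ≟ x ⟧)                  ≡⟨ +-identityˡ _ ⟨
    0# + sum (λ x → 1# * ⟦ 0# ≟ x ⟧)             ≡⟨ ≡.cong (_+ sum (λ x → 1# * ⟦ 0# ≟ x ⟧)) (S≡0 j j<N) ⟨
    S j + sum (λ x → 1# * ⟦ 0# ≟ x ⟧)            ≡⟨ ∑-distrib-+ (_^ j) (λ x → 1# * ⟦ 0# ≟ x ⟧) ⟨
    sum {p} (λ x → x ^ j + 1# * ⟦ 0# ≟ x ⟧)      ≡⟨ sum-cong-≋ {p} pointwise ⟩
    S 0                                          ≡⟨ S≡0 0 0<N ⟩
    0#                                           ∎) 1≉0
    where
    pointwise : ∀ x → x ^ j + 1# * ⟦ 0# ≟ x ⟧ ≡ 1#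
    pointwise x with 0# ≟ x
    ... | yes ≡.refl = ≡.trans (≡.cong₂ _+_ (0^ 0<j) (*-identityˡ 1#)) (+-identityˡ 1#)
    ... | no  0≢x    = ≡.trans (≡.cong₂ _+_ (decidable-stable (x ^ j ≟ 1#) (λ xʲ≢1 → none (x , 0≢x ∘ ≡.sym , xʲ≢1))) (zeroʳ 1#)) (+-identityʳ 1#)

  x^m≡1⇒x^km≡1 : ∀ {x} m k → x ^ m ≡ 1# → x ^ (k ℕ.* m) ≡ 1#
  x^m≡1⇒x^km≡1 {x} m k xᵐ≡1 = begin
    x ^ (k ℕ.* m)   ≡⟨ ≡.cong (x ^_) (ℕ.*-comm k m) ⟩
    x ^ (m ℕ.* k)   ≡⟨ ^-assocʳ x m k ⟨
    (x ^ m) ^ k     ≡⟨ ≡.cong (_^ k) xᵐ≡1 ⟩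
    1# ^ k          ≡⟨ 1^ k ⟩
    1#              ∎

  -- Bézout with natural coefficients: some multiple of one exponent exceeds a multiple of the other
  -- by 1, which accounts for the two cases.
  coprimeExponents : ∀ {x m n} → Coprime m n → x ^ m ≡ 1# → x ^ n ≡ 1# → x ≡ 1#
  coprimeExponents {x} {m} {n} m⊥n xᵐ≡1 xⁿ≡1 with Coprime.coprime-Bézout m⊥n
  ... | Bézout.+- i j eq = begin
    x                     ≡⟨ *-identityʳ x ⟨
    x * 1#                ≡⟨ ≡.cong (x *_) (x^m≡1⇒x^km≡1 n j xⁿ≡1) ⟨
    x ^ (1 ℕ.+ j ℕ.* n)   ≡⟨ ≡.cong (x ^_) eq ⟩
    x ^ (i ℕ.* m)         ≡⟨ x^m≡1⇒x^km≡1 m i xᵐ≡1 ⟩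
    1#                    ∎
  ... | Bézout.-+ i j eq = begin
    x                     ≡⟨ *-identityʳ x ⟨
    x * 1#                ≡⟨ ≡.cong (x *_) (x^m≡1⇒x^km≡1 m i xᵐ≡1) ⟨
    x ^ (1 ℕ.+ i ℕ.* m)   ≡⟨ ≡.cong (x ^_) eq ⟩
    x ^ (j ℕ.* n)         ≡⟨ x^m≡1⇒x^km≡1 n j xⁿ≡1 ⟩
    1#                    ∎

  -- Such an `x` has order exactly `q`: an exponent not divisible by the prime `q` is coprime to it
  -- and would force `x = 1`.
  primeExponent : ∀ {x q m} → Prime q → x ≢ 1# → x ^ q ≡ 1# → x ^ m ≡ 1# → q ∣ m
  primeExponent {x} {q} {m} q-prime x≢1 x^q≡1 xᵐ≡1 = decidable-stable (q ∣? m) (λ q∤m →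
    x≢1 (coprimeExponents {x} {q} {m} (λ {d} (d∣q , d∣m) → coprime q∤m d∣q d∣m) x^q≡1 xᵐ≡1))
    where
    coprime : q ∤ m → ∀ {d} → d ∣ q → d ∣ m → d ≡ 1
    coprime q∤m d∣q d∣m with prime⇒irreducible q-prime d∣q
    ... | inj₁ d≡1    = d≡1
    ... | inj₂ ≡.refl = contradiction d∣m q∤m

  record HasOrder (x : Carrier) (m : ℕ) : Set where
    field
      x^m≡1 : x ^ m ≡ 1#
      order : ∀ j → x ^ j ≡ 1# → m ∣ j
  open HasOrder

  -- Some q-th root of h is not an m-th root of unity: if one root is, it can be
  -- multiplied by a nontrivial q-th root of unity.
  raiseOrder : ∀ {h m q} → 0 ℕ.< m → Prime q → m ℕ.* q ∣ N → HasOrder h m → ∃ λ k → HasOrder k (m ℕ.* q)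
  raiseOrder {h} {m} {q} 0<m q-prime (divides t N≡t[mq]) h-order = k , record
    { x^m≡1 = begin
        k ^ (m ℕ.* q)   ≡⟨ ≡.cong (k ^_) (ℕ.*-comm m q) ⟩
        k ^ (q ℕ.* m)   ≡⟨ ^-assocʳ k q m ⟨
        (k ^ q) ^ m     ≡⟨ ≡.cong (_^ m) k^q≡h ⟩
        h ^ m           ≡⟨ x^m≡1 h-order ⟩
        1#              ∎
    ; order = λ j kʲ≡1 → divisible j kʲ≡1 (order h-order j (begin
        h ^ j           ≡⟨ ≡.cong (_^ j) k^q≡h ⟨
        (k ^ q) ^ j     ≡⟨ ^-assocʳ k q j ⟩
        k ^ (q ℕ.* j)   ≡⟨ x^m≡1⇒x^km≡1 j q kʲ≡1 ⟩
        1#              ∎))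
    }
    where
    1<q : 1 ℕ.< q
    1<q = ℕ.nonTrivial⇒n>1 q {{prime⇒nonTrivial q-prime}}
    0<q = ℕ.<⇒≤ 1<q
    -- The cofactor of `q` in `N`. Since `h ^ M = (h ^ m) ^ t = 1`, it is the exponent for which
    -- `root` extracts a q-th root of `h`.
    M = t ℕ.* m
    Mq≡N : M ℕ.* q ≡ N
    Mq≡N = ≡.trans (ℕ.*-assoc t m q) (≡.sym N≡t[mq])
    0<M : 0 ℕ.< M
    0<M = ℕ.n≢0⇒n>0 (λ M≡0 → ℕ.<⇒≢ 0<N (≡.trans (≡.cong (ℕ._* q) (≡.sym M≡0)) Mq≡N))
    M<N : M ℕ.< N
    M<N = ≡.subst (M ℕ.<_) Mq≡N (ℕ.m<m*n M q {{ℕ.>-nonZero 0<M}} 1<q)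

    choose : ∀ {k} → k ^ q ≡ h → ∃ λ k → k ^ q ≡ h × k ^ m ≢ 1#
    choose {k} k^q≡h with k ^ m ≟ 1#
    ... | no kᵐ≢1  = k , k^q≡h , kᵐ≢1
    ... | yes kᵐ≡1 = k * ω , kω^q≡h , kωᵐ≢1
      where
      x   = proj₁ (nonRoot 0<M M<N)
      x≢0 = proj₁ (proj₂ (nonRoot 0<M M<N))
      -- A nontrivial q-th root of unity, because its q-th power is `x ^ N`.
      ω   = x ^ M
      ω≢1 : ω ≢ 1#
      ω≢1 = proj₂ (proj₂ (nonRoot 0<M M<N))
      ω^q≡1 : ω ^ q ≡ 1#
      ω^q≡1 = ≡.trans (^-assocʳ x M q) (≡.trans (≡.cong (x ^_) Mq≡N) (x^[p-1]≡1 x≢0))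
      kω^q≡h : (k * ω) ^ q ≡ h
      kω^q≡h = ≡.trans (^-distrib-* k ω q) (≡.trans (≡.cong₂ _*_ k^q≡h ω^q≡1) (*-identityʳ h))
      -- If this power were 1, so would be `ω ^ m`, whence `q` divides `m`, say `m = m′ q`. But then
      -- `h ^ m′ = k ^ m = 1`, although `h` has order `m > m′`.
      kωᵐ≢1 : (k * ω) ^ m ≢ 1#
      kωᵐ≢1 kωᵐ≡1 with primeExponent {ω} {q} {m} q-prime ω≢1 ω^q≡1 (begin
        ω ^ m             ≡⟨ *-identityˡ _ ⟨
        1# * ω ^ m        ≡⟨ ≡.cong (_* ω ^ m) kᵐ≡1 ⟨
        k ^ m * ω ^ m     ≡⟨ ^-distrib-* k ω m ⟨
        (k * ω) ^ m       ≡⟨ kωᵐ≡1 ⟩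
        1#                ∎)
      ... | divides m′ m≡m′q = ℕ.<⇒≱ m′<m (∣⇒≤ {{ℕ.>-nonZero 0<m′}} (order h-order m′ (begin
        h ^ m′            ≡⟨ ≡.cong (_^ m′) k^q≡h ⟨
        (k ^ q) ^ m′      ≡⟨ ^-assocʳ k q m′ ⟩
        k ^ (q ℕ.* m′)    ≡⟨ ≡.cong (k ^_) (≡.trans (ℕ.*-comm q m′) (≡.sym m≡m′q)) ⟩
        k ^ m             ≡⟨ kᵐ≡1 ⟩
        1#                ∎)))
        where
        0<m′ : 0 ℕ.< m′
        0<m′ = ℕ.n≢0⇒n>0 (λ m′≡0 → ℕ.<⇒≢ 0<m (≡.trans (≡.cong (ℕ._* q) (≡.sym m′≡0)) (≡.sym m≡m′q)))
        m′<m : m′ ℕ.< m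
        m′<m = ≡.subst (m′ ℕ.<_) (≡.sym m≡m′q) (ℕ.m<m*n m′ q {{ℕ.>-nonZero 0<m′}} 1<q)

    chosen = choose (proj₂ (root {h} q M 0<q 0<M Mq≡N (x^m≡1⇒x^km≡1 m t (x^m≡1 h-order))))
    k = proj₁ chosen
    k^q≡h : k ^ q ≡ h
    k^q≡h = proj₁ (proj₂ chosen)
    kᵐ≢1 : k ^ m ≢ 1#
    kᵐ≢1 = proj₂ (proj₂ chosen)

    -- With `j = i m`, the element `k ^ m` has order `q` and its i-th power is 1, so `q` divides
    -- `i`.
    divisible : ∀ j → k ^ j ≡ 1# → m ∣ j → m ℕ.* q ∣ j
    divisible j kʲ≡1 (divides i ≡.refl) = ≡.subst (_∣ i ℕ.* m) (ℕ.*-comm q m) (*-monoˡ-∣ m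
      (primeExponent {k ^ m} {q} {i} q-prime kᵐ≢1
        (begin
          (k ^ m) ^ q      ≡⟨ ^-assocʳ k m q ⟩
          k ^ (m ℕ.* q)    ≡⟨ ≡.cong (k ^_) (ℕ.*-comm m q) ⟩
          k ^ (q ℕ.* m)    ≡⟨ ^-assocʳ k q m ⟨
          (k ^ q) ^ m      ≡⟨ ≡.cong (_^ m) k^q≡h ⟩
          h ^ m            ≡⟨ x^m≡1 h-order ⟩
          1#               ∎)
        (begin
          (k ^ m) ^ i      ≡⟨ ^-assocʳ k m i ⟩
          k ^ (m ℕ.* i)    ≡⟨ ≡.cong (k ^_) (ℕ.*-comm m i) ⟩
          k ^ (i ℕ.* m)    ≡⟨ kʲ≡1 ⟩
          1#               ∎)))

  -- The list `qs` holds the prime factors of `N` still missing from the order. Repeated primes are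
  -- covered, since `raiseOrder` allows `q` to divide `m`.
  extendOrder : ∀ {qs} → All Prime qs → ∀ {h m} → m ℕ.* product qs ≡ N → HasOrder h m → ∃ λ g → HasOrder g N
  extendOrder []                     {h} {m} eq h-order = h , ≡.subst (HasOrder h) (≡.trans (≡.sym (ℕ.*-identityʳ m)) eq) h-order
  extendOrder {q ∷ qs} (q-prime ∷ prime-qs) {h} {m} eq h-order =
    extendOrder prime-qs mq·≡N (proj₂ (raiseOrder 0<m q-prime (divides (product qs) (≡.trans (≡.sym mq·≡N) (ℕ.*-comm (m ℕ.* q) (product qs)))) h-order))
    where
    mq·≡N : m ℕ.* q ℕ.* product qs ≡ N
    mq·≡N = ≡.trans (ℕ.*-assoc m q (product qs)) eq
    0<m : 0 ℕ.< m
    0<m = ℕ.n≢0⇒n>0 (λ m≡0 → ℕ.<⇒≢ 0<N (≡.trans (≡.cong (ℕ._* product (q ∷ qs)) (≡.sym m≡0)) eq))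

  primitiveRoot : ∃ λ g → HasOrder g N
  primitiveRoot = extendOrder factorsPrime (≡.trans (ℕ.*-identityˡ _) (≡.sym isFactorisation))
    record { x^m≡1 = *-identityʳ 1# ; order = λ j _ → divides j (≡.sym (ℕ.*-identityʳ j)) }
    where open PrimeFactorisation (factorise N {{ℕ.>-nonZero 0<N}})

-- Discrete logarithms

module DiscreteLogarithm {p} (𝔽ₚ : PrimeField p) where
  open PrimeField 𝔽ₚ using (field𝔽)
  open PowerSums 𝔽ₚ using (N; 1+N≡p)
  open PrimitiveRoot 𝔽ₚ using (0<N; 0^; primitiveRoot; module HasOrder)
  open Field field𝔽
  open FieldProperties field𝔽 using (*-cancelʳ; ^-zero)
  open Exp semiring using (^-homo-*)
  open ≡.≡-Reasoning

  g : Fin p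
  g = proj₁ primitiveRoot

  open HasOrder (proj₂ primitiveRoot) renaming (x^m≡1 to g^N≡1; order to g-order)

  g^≢0 : ∀ i → g ^ i ≢ 0#
  g^≢0 i gⁱ≡0 = 1≉0 (begin
    1#       ≡⟨ g^N≡1 ⟨
    g ^ N    ≡⟨ ≡.cong (_^ N) (^-zero i gⁱ≡0) ⟩
    0# ^ N   ≡⟨ 0^ 0<N ⟩
    0#       ∎)

  exponents : ∀ {i j} → i ℕ.≤ j → g ^ i ≡ g ^ j → N ∣ j ℕ.∸ i
  exponents {i} {j} i≤j gⁱ≡gʲ = g-order (j ℕ.∸ i) (*-cancelʳ (g^≢0 i) (begin
    g ^ (j ℕ.∸ i) * g ^ i     ≡⟨ ^-homo-* g (j ℕ.∸ i) i ⟨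
    g ^ (j ℕ.∸ i ℕ.+ i)       ≡⟨ ≡.cong (g ^_) (ℕ.m∸n+n≡m i≤j) ⟩
    g ^ j                     ≡⟨ gⁱ≡gʲ ⟨
    g ^ i                     ≡⟨ *-identityˡ _ ⟨
    1# * g ^ i                ∎))

  exponent-≥ : ∀ {i j} → i ℕ.≤ j → j ℕ.< N → g ^ i ≡ g ^ j → j ℕ.≤ i
  exponent-≥ {i} {j} i≤j j<N eq with j ℕ.∸ i in j∸i | exponents i≤j eq
  ... | zero  | _   = ℕ.m∸n≡0⇒m≤n j∸i
  ... | suc k | N∣k = contradiction (∣⇒≤ N∣k) (ℕ.<⇒≱ (≡.subst (ℕ._< N) j∸i (ℕ.≤-<-trans (ℕ.m∸n≤m j i) j<N)))

  exponent-injective : ∀ {i j} → i ℕ.< N → j ℕ.< N → g ^ i ≡ g ^ j → i ≡ j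
  exponent-injective {i} {j} i<N j<N eq with ℕ.≤-total i j
  ... | inj₁ i≤j = ℕ.≤-antisym i≤j (exponent-≥ i≤j j<N eq)
  ... | inj₂ j≤i = ℕ.≤-antisym (exponent-≥ j≤i i<N (≡.sym eq)) j≤i

  -- Together with 0 the `N` distinct powers of `g` are as many as the elements of the field, so
  -- injectivity makes this map surjective and its preimages are the logarithms.
  0-or-power : Fin (suc N) → Fin p
  0-or-power Fin.zero    = 0#
  0-or-power (Fin.suc i) = g ^ toℕ i

  0-or-power-injective : Injective _≡_ _≡_ 0-or-power
  0-or-power-injective {Fin.zero}  {Fin.zero}  eq = ≡.refl
  0-or-power-injective {Fin.zero}  {Fin.suc j} eq = contradiction (≡.sym eq) (g^≢0 (toℕ j))
  0-or-power-injective {Fin.suc i} {Fin.zero}  eq = contradiction eq (g^≢0 (toℕ i))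
  0-or-power-injective {Fin.suc i} {Fin.suc j} eq =
    ≡.cong Fin.suc (Fin.toℕ-injective (exponent-injective (Fin.toℕ<n i) (Fin.toℕ<n j) eq))

  log : ∀ x → x ≢ 0# → ∃ λ (i : Fin N) → g ^ toℕ i ≡ x
  log x x≢0 with injective⇒surjective (ℕ.≤-reflexive (≡.sym 1+N≡p)) 0-or-power-injective x
  ... | Fin.zero  , 0≡x  = contradiction (≡.sym 0≡x) x≢0
  ... | Fin.suc i , gⁱ≡x = i , gⁱ≡x

-- Characters and their orthogonality

module Characters {p} (𝔽ₚ : PrimeField p) (K : Field c ℓ) where
  open DiscreteLogarithm 𝔽ₚ
  open PowerSums 𝔽ₚ using (N; 1+N≡p)
  open Field K
  open FieldProperties K using (*-cancelʳ)
  open FiniteSums semiring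
  open Sum semiring
  open Exp semiring using (^-homo-*; ^-assocʳ; ^-congˡ)
  open RingProperties ring using (+-cancelʳ)
  open SetoidReasoning setoid
  private
    module F where
      open Field (PrimeField.field𝔽 𝔽ₚ) public
      open FieldProperties (PrimeField.field𝔽 𝔽ₚ) public

  -- The conditions of `IsCharacter`, restated over the opaque operations of a `PrimeField`.
  record Character (χ : Fin p → Carrier) : Set ℓ where
    field
      χ-0 : χ F.0# ≈ 0#
      χ-1 : χ F.1# ≈ 1#
      χ-* : ∀ x y → χ (x F.* y) ≈ χ x * χ y

    χ≉0 : ∀ {x} → x ≢ F.0# → ¬ χ x ≈ 0#
    χ≉0 {x} x≢0 χx≈0 = let y , xy≡1 = F.inverse x x≢0 in 1≉0 (begin
      1#           ≈⟨ χ-1 ⟨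
      χ F.1#       ≡⟨ ≡.cong χ xy≡1 ⟨
      χ (x F.* y)  ≈⟨ χ-* x y ⟩
      χ x * χ y    ≈⟨ *-congʳ χx≈0 ⟩
      0# * χ y     ≈⟨ zeroˡ (χ y) ⟩
      0#           ∎)
  open Character

  _⊗_ : ∀ {χ ψ} → Character χ → Character ψ → Character (λ x → χ x * ψ x)
  χ-char ⊗ ψ-char = record
    { χ-0 = trans (*-congʳ (χ-0 χ-char)) (zeroˡ _)
    ; χ-1 = trans (*-cong (χ-1 χ-char) (χ-1 ψ-char)) (*-identityˡ 1#)
    ; χ-* = λ x y → trans (*-cong (χ-* χ-char x y) (χ-* ψ-char x y)) (interchange _ _ _ _)
    }
    where open CommutativeSemigroupProperties *-commutativeSemigroup using (interchange)

  -- What the definition of `φ` by cases yields directly. Multiplicativity is left out because it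
  -- has to be proved, as `φ-*`, by means of `g`.
  record IsQuadratic (φ : Fin p → Carrier) : Set ℓ where
    field
      φ-0         : φ F.0# ≈ 0#
      φ-square    : ∀ x → x ≢ F.0# → φ (x F.* x) ≈ 1#
      φ-nonsquare : ∀ x → (∀ y → y F.* y ≢ x) → φ x ≈ - 1#

  1^≈1 : ∀ m → 1# ^ m ≈ 1#
  1^≈1 zero    = refl
  1^≈1 (suc m) = trans (*-identityˡ _) (1^≈1 m)

  fixed⇒zero : ∀ {z s} → ¬ z ≈ 1# → z * s ≈ s → s ≈ 0#
  fixed⇒zero {z} {s} z≉1 zs≈s with s ≟ 0#
  ... | yes s≈0 = s≈0
  ... | no  s≉0 = contradiction (*-cancelʳ s≉0 (trans zs≈s (sym (*-identityˡ s)))) z≉1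

  -- Multiplication by `u` permutes the field, so the sum is unchanged when multiplied by `χ u`.
  Σχ≈0 : ∀ {χ} → Character χ → ∀ {u} → u ≢ F.0# → ¬ χ u ≈ 1# → sum χ ≈ 0#
  Σχ≈0 {χ} χ-char {u} u≢0 χu≉1 = fixed⇒zero χu≉1 (begin
    χ u * sum χ               ≈⟨ *-distribˡ-sum (χ u) χ ⟩
    sum (λ x → χ u * χ x)     ≈⟨ sum-cong-≋ (λ x → χ-* χ-char u x) ⟨
    sum (λ x → χ (u F.* x))   ≈⟨ sum-reindex χ (λ {x} {y} eq → F.*-cancelʳ u≢0 (≡.trans (F.*-comm x u) (≡.trans eq (F.*-comm u y)))) ⟩
    sum χ                     ∎)

  module _ {z : Carrier} (zᴺ≈1 : z ^ N ≈ 1#) where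
    z^-cong-≤ : ∀ {i j} → i ℕ.≤ j → g F.^ i ≡ g F.^ j → z ^ i ≈ z ^ j
    z^-cong-≤ {i} {j} i≤j eq with exponents i≤j eq
    ... | divides k j∸i≡kN = begin
      z ^ i                        ≈⟨ *-identityʳ _ ⟨
      z ^ i * 1#                   ≈⟨ *-congˡ (1^≈1 k) ⟨
      z ^ i * 1# ^ k               ≈⟨ *-congˡ (^-congˡ k zᴺ≈1) ⟨
      z ^ i * (z ^ N) ^ k          ≈⟨ *-congˡ (^-assocʳ z N k) ⟩
      z ^ i * z ^ (N ℕ.* k)        ≈⟨ ^-homo-* z i (N ℕ.* k) ⟨
      z ^ (i ℕ.+ N ℕ.* k)          ≡⟨ ≡.cong (λ m → z ^ (i ℕ.+ m)) (≡.trans (ℕ.*-comm N k) (≡.sym j∸i≡kN)) ⟩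
      z ^ (i ℕ.+ (j ℕ.∸ i))        ≡⟨ ≡.cong (z ^_) (ℕ.m+[n∸m]≡n i≤j) ⟩
      z ^ j                        ∎

    -- Equal powers of `g` have exponents congruent modulo `N`, and `z ^ N = 1`. This makes
    -- characters defined through logarithms well defined and multiplicative.
    z^-cong : ∀ i j → g F.^ i ≡ g F.^ j → z ^ i ≈ z ^ j
    z^-cong i j eq with ℕ.≤-total i j
    ... | inj₁ i≤j = z^-cong-≤ i≤j eq
    ... | inj₂ j≤i = sym (z^-cong-≤ j≤i (≡.sym eq))

    -- The character with value z at the primitive root g.
    powerCharacter : Fin p → Carrier
    powerCharacter x with x F.≟ F.0#
    ... | yes _   = 0#
    ... | no  x≢0 = z ^ toℕ (proj₁ (log x x≢0))

    powerCharacter-0 : powerCharacter F.0# ≈ 0#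
    powerCharacter-0 with F.0# F.≟ F.0#
    ... | yes _  = refl
    ... | no 0≢0 = contradiction ≡.refl 0≢0

    powerCharacter-g^ : ∀ i {x} → g F.^ i ≡ x → powerCharacter x ≈ z ^ i
    powerCharacter-g^ i {x} gⁱ≡x with x F.≟ F.0#
    ... | yes x≡0 = contradiction (≡.trans gⁱ≡x x≡0) (g^≢0 i)
    ... | no  x≢0 = z^-cong (toℕ (proj₁ (log x x≢0))) i (≡.trans (proj₂ (log x x≢0)) (≡.sym gⁱ≡x))

    powerCharacter-character : Character powerCharacter
    powerCharacter-character = record
      { χ-0 = powerCharacter-0
      ; χ-1 = powerCharacter-g^ 0 ≡.refl
      ; χ-* = multiplicative
      }
      where
      multiplicative : ∀ x y → powerCharacter (x F.* y) ≈ powerCharacter x * powerCharacter y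
      multiplicative x y with x F.≟ F.0# | y F.≟ F.0#
      ... | yes ≡.refl | _          = trans (reflexive (≡.cong powerCharacter (F.zeroˡ y))) (trans powerCharacter-0 (sym (zeroˡ _)))
      ... | no _       | yes ≡.refl = trans (reflexive (≡.cong powerCharacter (F.zeroʳ x))) (trans powerCharacter-0 (sym (zeroʳ _)))
      ... | no x≢0     | no y≢0     = trans
        (powerCharacter-g^ (toℕ i ℕ.+ toℕ j) (≡.trans (Exp.^-homo-* F.semiring g (toℕ i) (toℕ j)) (≡.cong₂ F._*_ gⁱ≡x gʲ≡y)))
        (^-homo-* z (toℕ i) (toℕ j))
        where
        i    = proj₁ (log x x≢0)
        gⁱ≡x = proj₂ (log x x≢0)
        j    = proj₁ (log y y≢0)
        gʲ≡y = proj₂ (log y y≢0)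

  trivial : Fin p → Carrier
  trivial = powerCharacter (1^≈1 N)

  trivial≈1 : ∀ {x} → x ≢ F.0# → trivial x ≈ 1#
  trivial≈1 {x} x≢0 = let i , gⁱ≡x = log x x≢0 in
    trans (powerCharacter-g^ (1^≈1 N) (toℕ i) gⁱ≡x) (1^≈1 (toℕ i))

  Σtrivial≈N : sum trivial ≈ fromℕ# N
  Σtrivial≈N = +-cancelʳ 1# _ _ (begin
    sum trivial + 1#                                  ≈⟨ +-congˡ (sum-⟦≟⟧ (λ _ → 1#) F.0#) ⟨
    sum trivial + sum (λ x → 1# * ⟦ F.0# F.≟ x ⟧)     ≈⟨ ∑-distrib-+ trivial (λ x → 1# * ⟦ F.0# F.≟ x ⟧) ⟨
    sum (λ x → trivial x + 1# * ⟦ F.0# F.≟ x ⟧)       ≈⟨ sum-cong-≋ pointwise ⟩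
    sum {p} (λ _ → 1#)                                ≈⟨ sum-replicate p ⟩
    fromℕ# p                                          ≡⟨ ≡.cong fromℕ# 1+N≡p ⟨
    1# + fromℕ# N                                     ≈⟨ +-comm 1# _ ⟩
    fromℕ# N + 1#                                     ∎)
    where
    pointwise : ∀ x → trivial x + 1# * ⟦ F.0# F.≟ x ⟧ ≈ 1#
    pointwise x with F.0# F.≟ x
    ... | yes ≡.refl = trans (+-cong (powerCharacter-0 (1^≈1 N)) (*-identityˡ 1#)) (+-identityˡ 1#)
    ... | no  0≢x    = trans (+-cong (trivial≈1 (0≢x ∘ ≡.sym)) (zeroʳ 1#)) (+-identityʳ 1#)

  -- The length `L` of the family is not known to be `N` beforehand; `column-1` establishes this as
  -- an equation in `K`.
  module Orthogonality {L} (χ : Fin L → Fin p → Carrier)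
    (χ-character : ∀ i → Character (χ i))
    (χ-complete  : ∀ {ψ} → Character ψ → ∃ λ i → ∀ x → χ i x ≈ ψ x)
    (χ-injective : ∀ i j → (∀ x → χ i x ≈ χ j x) → i ≡ j)
    {ζ : Carrier} (ζ-primitive : IsPrimitiveRootOfUnity N ζ) where
    open IsPrimitiveRootOfUnity ζ-primitive

    -- It takes the value `ζ` at `g`. As `ζ` is primitive, it separates 1 from every other nonzero
    -- element.
    faithful : Fin p → Carrier
    faithful = powerCharacter ζ^n≈1

    faithful≈1⇒≡1 : ∀ {u} → u ≢ F.0# → faithful u ≈ 1# → u ≡ F.1#
    faithful≈1⇒≡1 {u} u≢0 eq with log u u≢0
    ... | i , gⁱ≡u with toℕ i in i≡k
    ...   | zero  = ≡.sym gⁱ≡u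
    ...   | suc k = contradiction (trans (sym (powerCharacter-g^ ζ^n≈1 (suc k) gⁱ≡u)) eq)
                      (ζ^k≉1 (suc k) (s≤s z≤n) (≡.subst (ℕ._< N) i≡k (Fin.toℕ<n i)))

    -- Multiplication by `faithful`, seen as a permutation of the indices: completeness of the
    -- family supplies the new index.
    twist : Fin L → Fin L
    twist i = proj₁ (χ-complete (powerCharacter-character ζ^n≈1 ⊗ χ-character i))

    χ-twist : ∀ i x → χ (twist i) x ≈ faithful x * χ i x
    χ-twist i = proj₂ (χ-complete (powerCharacter-character ζ^n≈1 ⊗ χ-character i))

    twist-injective : Injective _≡_ _≡_ twist
    twist-injective {i} {j} eq = χ-injective i j agree
      where
      agree : ∀ x → χ i x ≈ χ j x
      agree x with x F.≟ F.0#
      ... | yes ≡.refl = trans (χ-0 (χ-character i)) (sym (χ-0 (χ-character j)))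
      ... | no x≢0 = *-cancelʳ (χ≉0 (powerCharacter-character ζ^n≈1) x≢0) (begin
        χ i x * faithful x    ≈⟨ *-comm _ _ ⟩
        faithful x * χ i x    ≈⟨ χ-twist i x ⟨
        χ (twist i) x         ≡⟨ ≡.cong (λ k → χ k x) eq ⟩
        χ (twist j) x         ≈⟨ χ-twist j x ⟩
        faithful x * χ j x    ≈⟨ *-comm _ _ ⟩
        χ j x * faithful x    ∎)

    -- For `u ≠ 0`, twisting permutes the summands and multiplies their sum by `faithful u`, which
    -- differs from 1.
    column-≢1 : ∀ {u} → u ≢ F.1# → sum (λ i → χ i u) ≈ 0#
    column-≢1 {u} u≢1 with u F.≟ F.0#
    ... | yes ≡.refl = sum-zero (λ i → χ-0 (χ-character i))
    ... | no u≢0 = fixed⇒zero (u≢1 ∘ faithful≈1⇒≡1 u≢0) (begin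
      faithful u * sum (λ i → χ i u)    ≈⟨ *-distribˡ-sum (faithful u) (λ i → χ i u) ⟩
      sum (λ i → faithful u * χ i u)    ≈⟨ sum-cong-≋ (λ i → χ-twist i u) ⟨
      sum (λ i → χ (twist i) u)         ≈⟨ sum-reindex (λ i → χ i u) twist-injective ⟩
      sum (λ i → χ i u)                 ∎)

    row-trivial : ∃ λ i → ∀ x → χ i x ≈ trivial x
    row-trivial = χ-complete (powerCharacter-character (1^≈1 N))

    row-nontrivial : ∀ j → j ≢ proj₁ row-trivial → sum (χ j) ≈ 0#
    row-nontrivial j j≢i with Fin.any? (λ u → ¬? (u F.≟ F.0#) ×-dec ¬? (χ j u ≟ 1#))
    ... | yes (u , u≢0 , χu≉1) = Σχ≈0 (χ-character j) u≢0 χu≉1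
    ... | no none = contradiction (χ-injective j _ agree) j≢i
      where
      agree : ∀ x → χ j x ≈ χ (proj₁ row-trivial) x
      agree x with x F.≟ F.0#
      ... | yes ≡.refl = trans (χ-0 (χ-character j)) (sym (χ-0 (χ-character _)))
      ... | no x≢0 = trans (decidable-stable (χ j x ≟ 1#) (λ χx≉1 → none (x , x≢0 , χx≉1)))
                       (sym (trans (proj₂ row-trivial x) (trivial≈1 x≢0)))

    -- Both sides are the sum of χ u over all χ and u.
    column-1 : sum (λ i → χ i F.1#) ≈ fromℕ# N
    column-1 = begin
      sum (λ i → χ i F.1#)                    ≈⟨ sum-single (λ u → sum (λ i → χ i u)) F.1# (λ u u≢1 → column-≢1 u≢1) ⟨
      sum {p} (λ u → sum {L} (λ i → χ i u))   ≈⟨ ∑-comm {p} {L} (λ u i → χ i u) ⟩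
      sum {L} (λ i → sum {p} (χ i))           ≈⟨ sum-single (λ i → sum (χ i)) _ row-nontrivial ⟩
      sum (χ (proj₁ row-trivial))             ≈⟨ sum-cong-≋ (proj₂ row-trivial) ⟩
      sum trivial                             ≈⟨ Σtrivial≈N ⟩
      fromℕ# N                                ∎

    orthogonality : ∀ u → sum (λ i → χ i u) ≈ fromℕ# N * ⟦ F.1# F.≟ u ⟧
    orthogonality u with F.1# F.≟ u
    ... | yes ≡.refl = trans column-1 (sym (*-identityʳ _))
    ... | no 1≢u     = trans (column-≢1 (1≢u ∘ ≡.sym)) (sym (zeroʳ _))

-- The total inverse of a field

module FieldInverse (K : Field c ℓ) where
  open Field K
  open FieldProperties K

  *-inverseʳ : ∀ {x} → ¬ x ≈ 0# → x * x ⁻¹ ≈ 1#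
  *-inverseʳ {x} x≉0 with x ≟ 0#
  ... | yes x≈0 = contradiction x≈0 x≉0
  ... | no x≉0′ = proj₂ (inverse x x≉0′)

  *-inverseˡ : ∀ {x} → ¬ x ≈ 0# → x ⁻¹ * x ≈ 1#
  *-inverseˡ x≉0 = trans (*-comm _ _) (*-inverseʳ x≉0)

  ⁻¹-zero : ∀ {x} → x ≈ 0# → x ⁻¹ ≈ 0#
  ⁻¹-zero {x} x≈0 with x ≟ 0#
  ... | yes _  = refl
  ... | no x≉0 = contradiction x≈0 x≉0

  inverse-unique : ∀ {x y} → x * y ≈ 1# → x ⁻¹ ≈ y
  inverse-unique {x} {y} xy≈1 = *-cancelʳ x≉0 (trans (*-inverseˡ x≉0) (trans (sym xy≈1) (*-comm x y)))
    where
    x≉0 : ¬ x ≈ 0#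
    x≉0 x≈0 = 1≉0 (trans (sym xy≈1) (trans (*-congʳ x≈0) (zeroˡ y)))

  -- Including 0 matters: inversion becomes a permutation of the whole field, as needed for the
  -- substitution in `conicSum`.
  ⁻¹-involutive : ∀ x → x ⁻¹ ⁻¹ ≈ x
  ⁻¹-involutive x = byCases (x ≟ 0#)
    where
    byCases : Dec (x ≈ 0#) → x ⁻¹ ⁻¹ ≈ x
    byCases (yes x≈0) = trans (⁻¹-zero (⁻¹-zero x≈0)) (sym x≈0)
    byCases (no x≉0)  = inverse-unique (*-inverseˡ x≉0)

parity : ∀ n → ∃ λ j → n ≡ j ℕ.+ j ⊎ n ≡ suc (j ℕ.+ j)
parity zero    = 0 , inj₁ ≡.refl
parity (suc n) with parity n
... | j , inj₁ n≡j+j = j , inj₂ (≡.cong suc n≡j+j)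
... | j , inj₂ n≡1+j+j = suc j , inj₁ (≡.cong suc (≡.trans n≡1+j+j (≡.sym (ℕ.+-suc j j))))

-- The quadratic character

module QuadraticCharacter {p} (𝔽ₚ : PrimeField p) (K : Field c ℓ) (charZero : Field.CharacteristicZero K)
  (N-even : ∃ λ j → p ℕ.∸ 1 ≡ j ℕ.+ j) (φ : Fin p → Field.Carrier K)
  (isQuadratic : Characters.IsQuadratic 𝔽ₚ K φ)
  where
  open Field K
  open DiscreteLogarithm 𝔽ₚ
  open PrimeField 𝔽ₚ using (1<p; ·-zero)
  open PowerSums 𝔽ₚ using (N; 1+N≡p)
  open PrimitiveRoot 𝔽ₚ using (0<N)
  open Characters 𝔽ₚ K
  open FiniteSums semiring
  open Sum semiring
  open Exp semiring using (^-homo-*; ^-congʳ)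
  open RingProperties ring using (-‿involutive; -1*x≈-x)
  open CommutativeSemigroupProperties *-commutativeSemigroup using (x∙yz≈y∙xz)
  open SetoidReasoning setoid
  open Character
  private module F = Field (PrimeField.field𝔽 𝔽ₚ)
  open IntegerSolver F.commutativeRing
  open IsQuadratic isQuadratic
  private
    module FP where
      open FieldProperties (PrimeField.field𝔽 𝔽ₚ) public
      open FieldInverse (PrimeField.field𝔽 𝔽ₚ) public
      open RingProperties F.ring public
    module F≡ = ≡.≡-Reasoning
    module KS = IntegerSolver commutativeRing
    module KP = FieldInverse K
    :1 : ∀ {n} → Polynomial n
    :1 = con ℤ.1ℤ

  1≉-1 : ¬ 1# ≈ - 1#
  1≉-1 1≈-1 = charZero 2 (begin
    1# + (1# + 0#)    ≈⟨ +-congˡ (+-identityʳ 1#) ⟩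
    1# + 1#           ≈⟨ +-congˡ 1≈-1 ⟩
    1# - 1#           ≈⟨ -‿inverseʳ 1# ⟩
    0#                ∎)

  -1^even : ∀ j → (- 1#) ^ (j ℕ.+ j) ≈ 1#
  -1^even zero    = refl
  -1^even (suc j) = begin
    - 1# * (- 1#) ^ (j ℕ.+ suc j)        ≡⟨ ≡.cong (λ m → - 1# * (- 1#) ^ m) (ℕ.+-suc j j) ⟩
    - 1# * (- 1# * (- 1#) ^ (j ℕ.+ j))   ≈⟨ *-congˡ (*-congˡ (-1^even j)) ⟩
    - 1# * (- 1# * 1#)                   ≈⟨ *-congˡ (*-identityʳ _) ⟩
    - 1# * - 1#                          ≈⟨ -1*x≈-x (- 1#) ⟩
    - - 1#                               ≈⟨ -‿involutive 1# ⟩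
    1#                                   ∎

  -1^odd : ∀ j → (- 1#) ^ suc (j ℕ.+ j) ≈ - 1#
  -1^odd j = trans (*-congˡ (-1^even j)) (*-identityʳ _)

  -1^N≈1 : (- 1#) ^ N ≈ 1#
  -1^N≈1 = trans (^-congʳ (- 1#) (proj₂ N-even)) (-1^even (proj₁ N-even))

  -- As `N` is even, the sign `(- 1#) ^ i` depends only on `g ^ i`. So an odd power of `g` cannot
  -- equal the square of any `g ^ k`, whose sign is 1.
  φ-g^ : ∀ i {x} → g F.^ i ≡ x → φ x ≈ (- 1#) ^ i
  φ-g^ i {x} gⁱ≡x with parity i
  ... | j , inj₁ ≡.refl = begin
    φ x                        ≡⟨ ≡.cong φ (≡.trans (≡.sym gⁱ≡x) (Exp.^-homo-* F.semiring g j j)) ⟩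
    φ (g F.^ j F.* g F.^ j)    ≈⟨ φ-square _ (g^≢0 j) ⟩
    1#                         ≈⟨ -1^even j ⟨
    (- 1#) ^ (j ℕ.+ j)         ∎
  ... | j , inj₂ ≡.refl = trans (φ-nonsquare x nonsquare) (sym (-1^odd j))
    where
    nonsquare : ∀ y → y F.* y ≢ x
    nonsquare y yy≡x = 1≉-1 (begin
      1#                       ≈⟨ -1^even k ⟨
      (- 1#) ^ (k ℕ.+ k)       ≈⟨ z^-cong -1^N≈1 (k ℕ.+ k) (suc (j ℕ.+ j)) (≡.trans (Exp.^-homo-* F.semiring g k k) (≡.trans (≡.cong₂ F._*_ gᵏ≡y gᵏ≡y) (≡.trans yy≡x (≡.sym gⁱ≡x)))) ⟩
      (- 1#) ^ suc (j ℕ.+ j)   ≈⟨ -1^odd j ⟩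
      - 1#                     ∎)
      where
      y≢0 : y ≢ F.0#
      y≢0 ≡.refl = g^≢0 (suc (j ℕ.+ j)) (≡.trans gⁱ≡x (≡.trans (≡.sym yy≡x) (F.zeroˡ F.0#)))
      k = toℕ (proj₁ (log y y≢0))
      gᵏ≡y : g F.^ k ≡ y
      gᵏ≡y = proj₂ (log y y≢0)

  φ-* : ∀ x y → φ (x F.* y) ≈ φ x * φ y
  φ-* x y with x F.≟ F.0# | y F.≟ F.0#
  ... | yes ≡.refl | _          = trans (reflexive (≡.cong φ (F.zeroˡ y))) (trans φ-0 (sym (trans (*-congʳ φ-0) (zeroˡ _))))
  ... | no _       | yes ≡.refl = trans (reflexive (≡.cong φ (F.zeroʳ x))) (trans φ-0 (sym (trans (*-congˡ φ-0) (zeroʳ _))))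
  ... | no x≢0     | no y≢0     = begin
    φ (x F.* y)                      ≈⟨ φ-g^ (i ℕ.+ j) (≡.trans (Exp.^-homo-* F.semiring g i j) (≡.cong₂ F._*_ gⁱ≡x gʲ≡y)) ⟩
    (- 1#) ^ (i ℕ.+ j)               ≈⟨ ^-homo-* (- 1#) i j ⟩
    (- 1#) ^ i * (- 1#) ^ j          ≈⟨ *-cong (φ-g^ i gⁱ≡x) (φ-g^ j gʲ≡y) ⟨
    φ x * φ y                        ∎
    where
    i    = toℕ (proj₁ (log x x≢0))
    gⁱ≡x = proj₂ (log x x≢0)
    j    = toℕ (proj₁ (log y y≢0))
    gʲ≡y = proj₂ (log y y≢0)

  φ-1 : φ F.1# ≈ 1#
  φ-1 = φ-g^ 0 ≡.refl

  φ-character : Character φ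
  φ-character = record { χ-0 = φ-0 ; χ-1 = φ-1 ; χ-* = φ-* }

  φx*φx≈1 : ∀ {x} → x ≢ F.0# → φ x * φ x ≈ 1#
  φx*φx≈1 {x} x≢0 = trans (sym (φ-* x x)) (φ-square x x≢0)

  Σφ≈0 : sum φ ≈ 0#
  Σφ≈0 = Σχ≈0 φ-character (g^≢0 1) (λ φg≈1 → 1≉-1 (trans (sym φg≈1) (trans (φ-g^ 1 ≡.refl) (-1^odd 0))))

  -- For `x ≠ 0` the value `φ x` is its own inverse, which turns the character of a quotient into a
  -- product.
  φ-quotient : ∀ {s x y} → x ≢ F.0# → s F.* x ≡ y → φ s ≈ φ x * φ y
  φ-quotient {s} {x} {y} x≢0 sx≡y = begin
    φ s                     ≈⟨ *-identityʳ _ ⟨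
    φ s * 1#                ≈⟨ *-congˡ (φx*φx≈1 x≢0) ⟨
    φ s * (φ x * φ x)       ≈⟨ *-assoc _ _ _ ⟨
    φ s * φ x * φ x         ≈⟨ *-comm _ _ ⟩
    φ x * (φ s * φ x)       ≈⟨ *-congˡ (φ-* s x) ⟨
    φ x * φ (s F.* x)       ≡⟨ ≡.cong (λ t → φ x * φ t) sx≡y ⟩
    φ x * φ y               ∎

  -- Square roots and points of conics

  2<p : 2 ℕ.< p
  2<p = ≡.subst (2 ℕ.<_) 1+N≡p (s≤s (2≤N (proj₁ N-even) (proj₂ N-even)))
    where
    2≤N : ∀ j → N ≡ j ℕ.+ j → 2 ℕ.≤ N
    2≤N zero    N≡0 = contradiction 0<N (ℕ.≤⇒≯ (ℕ.≤-reflexive N≡0))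
    2≤N (suc j) N≡  = ≡.subst (2 ℕ.≤_) (≡.sym (≡.trans N≡ (≡.cong suc (ℕ.+-suc j j)))) (s≤s (s≤s z≤n))

  -v≢v : ∀ {v} → v ≢ F.0# → F.- v ≢ v
  -v≢v {v} v≢0 -v≡v = v≢0 (·-zero {2} v (s≤s z≤n) 2<p (≡.trans (≡.cong (v F.+_) (F.+-identityʳ v))
    (≡.trans (≡.cong (F._+ v) (≡.sym -v≡v)) (F.-‿inverseˡ v))))

  square-zero : ∀ {x} → x F.* x ≡ F.0# → x ≡ F.0#
  square-zero {x} xx≡0 with FP.zeroProduct xx≡0
  ... | inj₁ x≡0 = x≡0
  ... | inj₂ x≡0 = x≡0

  squareRoots : ∀ u → sum (λ x → ⟦ x F.* x F.≟ u ⟧) ≈ 1# + φ u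
  squareRoots u with Fin.any? (λ v → v F.* v F.≟ u)
  ... | no none = begin
    sum (λ x → ⟦ x F.* x F.≟ u ⟧)    ≈⟨ sum-zero (λ x → ⟦⟧-no (x F.* x F.≟ u) (λ xx≡u → none (x , xx≡u))) ⟩
    0#                               ≈⟨ -‿inverseʳ 1# ⟨
    1# - 1#                          ≈⟨ +-congˡ (φ-nonsquare u (λ v vv≡u → none (v , vv≡u))) ⟨
    1# + φ u                         ∎
  ... | yes (v , ≡.refl) with v F.≟ F.0#
  ...   | yes ≡.refl = begin
    sum (λ x → ⟦ x F.* x F.≟ F.0# F.* F.0# ⟧)
      ≈⟨ sum-single _ F.0# (λ x x≢0 → ⟦⟧-no (x F.* x F.≟ F.0# F.* F.0#) (λ eq → x≢0 (square-zero (≡.trans eq (F.zeroˡ F.0#))))) ⟩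
    ⟦ F.0# F.* F.0# F.≟ F.0# F.* F.0# ⟧   ≈⟨ ⟦⟧-yes (F.0# F.* F.0# F.≟ F.0# F.* F.0#) ≡.refl ⟩
    1#                                    ≈⟨ +-identityʳ 1# ⟨
    1# + 0#                               ≈⟨ +-congˡ (trans (reflexive (≡.cong φ (F.zeroˡ F.0#))) φ-0) ⟨
    1# + φ (F.0# F.* F.0#)                ∎
  ...   | no v≢0 = begin
    sum (λ x → ⟦ x F.* x F.≟ v F.* v ⟧)   ≈⟨ sum-cong-≋ twoRoots ⟩
    sum (λ x → 1# * ⟦ v F.≟ x ⟧ + 1# * ⟦ F.- v F.≟ x ⟧)
      ≈⟨ ∑-distrib-+ (λ x → 1# * ⟦ v F.≟ x ⟧) (λ x → 1# * ⟦ F.- v F.≟ x ⟧) ⟩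
    sum (λ x → 1# * ⟦ v F.≟ x ⟧) + sum (λ x → 1# * ⟦ F.- v F.≟ x ⟧)
      ≈⟨ +-cong (sum-⟦≟⟧ (λ _ → 1#) v) (sum-⟦≟⟧ (λ _ → 1#) (F.- v)) ⟩
    1# + 1#                               ≈⟨ +-congˡ (φ-square v v≢0) ⟨
    1# + φ (v F.* v)                      ∎
    where
    twoRoots : ∀ x → ⟦ x F.* x F.≟ v F.* v ⟧ ≈ 1# * ⟦ v F.≟ x ⟧ + 1# * ⟦ F.- v F.≟ x ⟧
    twoRoots x with v F.≟ x | F.- v F.≟ x
    ... | yes ≡.refl | yes -v≡v   = contradiction -v≡v (-v≢v v≢0)
    ... | yes ≡.refl | no _       = trans (⟦⟧-yes (v F.* v F.≟ v F.* v) ≡.refl) (sym (trans (+-cong (*-identityˡ 1#) (zeroʳ 1#)) (+-identityʳ 1#)))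
    ... | no _       | yes ≡.refl = trans (⟦⟧-yes (F.- v F.* F.- v F.≟ v F.* v) (solve 1 (λ v → :- v :* :- v := v :* v) ≡.refl v))
      (sym (trans (+-cong (zeroʳ 1#) (*-identityˡ 1#)) (+-identityˡ 1#)))
    ... | no v≢x     | no -v≢x    = trans (⟦⟧-no (x F.* x F.≟ v F.* v) noRoot)
      (sym (trans (+-cong (zeroʳ 1#) (zeroʳ 1#)) (+-identityˡ 0#)))
      where
      noRoot : x F.* x ≢ v F.* v
      noRoot xx≡vv with FP.zeroProduct {x F.- v} {x F.- F.- v} (≡.trans
        (solve 2 (λ x v → (x :- v) :* (x :- :- v) := x :* x :- v :* v) ≡.refl x v) (FP.x≈y⇒x∙y⁻¹≈ε xx≡vv))
      ... | inj₁ eq = v≢x (≡.sym (FP.x∙y⁻¹≈ε⇒x≈y _ _ eq))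
      ... | inj₂ eq = -v≢x (≡.sym (FP.x∙y⁻¹≈ε⇒x≈y _ _ eq))

  -- The left side counts the points (Y : T) with Y² A = T² B, the point (1 : 0)
  -- first.
  ℙ¹-count : ∀ A B → ¬ (A ≡ F.0# × B ≡ F.0#) →
             ⟦ A F.≟ F.0# ⟧ + sum (λ y → ⟦ y F.* y F.* A F.≟ B ⟧) ≈ 1# + φ A * φ B
  ℙ¹-count A B AB≢0 with A F.≟ F.0#
  ... | yes ≡.refl = +-congˡ (trans
    (sum-zero (λ y → ⟦⟧-no (y F.* y F.* F.0# F.≟ B) (λ eq → AB≢0 (≡.refl , ≡.trans (≡.sym eq) (F.zeroʳ (y F.* y))))))
    (sym (trans (*-congʳ φ-0) (zeroˡ _))))
  ... | no A≢0 = begin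
    0# + sum (λ y → ⟦ y F.* y F.* A F.≟ B ⟧)     ≈⟨ +-identityˡ _ ⟩
    sum (λ y → ⟦ y F.* y F.* A F.≟ B ⟧)
      ≈⟨ sum-cong-≋ (λ y → ⟦⟧-cong (y F.* y F.* A F.≟ B) (y F.* y F.≟ s)
           (λ eq → FP.*-cancelʳ A≢0 (≡.trans eq (≡.sym sA≡B))) (λ eq → ≡.trans (≡.cong (F._* A) eq) sA≡B)) ⟩
    sum (λ y → ⟦ y F.* y F.≟ s ⟧)                ≈⟨ squareRoots s ⟩
    1# + φ s                                     ≈⟨ +-congˡ (φ-quotient A≢0 sA≡B) ⟩
    1# + φ A * φ B                               ∎
    where
    s = B F.* A F.⁻¹
    sA≡B : s F.* A ≡ B
    sA≡B = ≡.trans (F.*-assoc B _ A) (≡.trans (≡.cong (B F.*_) (FP.*-inverseˡ A≢0)) (F.*-identityʳ B))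

  -- Group the `x` by their squares: each `u` occurs once for each of its `1 + φ u` square roots.
  sum-squares : ∀ (h : Fin p → Carrier) → sum (λ x → h (x F.* x)) ≈ sum (λ u → (1# + φ u) * h u)
  sum-squares h = begin
    sum (λ x → h (x F.* x))                                          ≈⟨ sum-cong-≋ (λ x → sum-⟦≟⟧ h (x F.* x)) ⟨
    sum {p} (λ x → sum {p} (λ u → h u * ⟦ x F.* x F.≟ u ⟧))          ≈⟨ ∑-comm {p} {p} (λ x u → h u * ⟦ x F.* x F.≟ u ⟧) ⟩
    sum {p} (λ u → sum {p} (λ x → h u * ⟦ x F.* x F.≟ u ⟧))          ≈⟨ sum-cong-≋ {p} (λ u → *-distribˡ-sum {p} (h u) (λ x → ⟦ x F.* x F.≟ u ⟧)) ⟨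
    sum (λ u → h u * sum (λ x → ⟦ x F.* x F.≟ u ⟧))                  ≈⟨ sum-cong-≋ {p} (λ u → trans (*-congˡ (squareRoots u)) (*-comm _ _)) ⟩
    sum (λ u → (1# + φ u) * h u)                                     ∎

  -- For `y ≠ 1` the summand is `φ` of the quotient (1 - μy) / (1 - y), with μ the square of `m`.
  -- This Möbius map misses only μ, its value at infinity; putting μ at the pole `y = 1` makes it a
  -- permutation. As `φ μ = 1`, the sum completed by 1 is the sum of `φ` over the field.
  conicSum : ∀ {m} → m ≢ F.0# → F.1# ≢ m F.* m →
             sum (λ y → φ (F.1# F.- y) * φ (F.1# F.- m F.* m F.* y)) + 1# ≈ 0#
  conicSum {m} m≢0 1≢μ = begin
    sum (λ y → φ (F.1# F.- y) * φ (F.1# F.- μ F.* y)) + 1#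
      ≈⟨ +-congˡ (sum-⟦≟⟧ (λ _ → 1#) F.1#) ⟨
    sum (λ y → φ (F.1# F.- y) * φ (F.1# F.- μ F.* y)) + sum (λ y → 1# * ⟦ F.1# F.≟ y ⟧)
      ≈⟨ ∑-distrib-+ (λ y → φ (F.1# F.- y) * φ (F.1# F.- μ F.* y)) (λ y → 1# * ⟦ F.1# F.≟ y ⟧) ⟨
    sum (λ y → φ (F.1# F.- y) * φ (F.1# F.- μ F.* y) + 1# * ⟦ F.1# F.≟ y ⟧)
      ≈⟨ sum-cong-≋ pointwise ⟨
    sum (λ y → φ (t y))     ≈⟨ sum-reindex φ t-injective ⟩
    sum φ                   ≈⟨ Σφ≈0 ⟩
    0#                      ∎
    where
    μ = m F.* m
    ν = F.1# F.- μ
    ν≢0 : ν ≢ F.0#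
    ν≢0 ν≡0 = 1≢μ (FP.x∙y⁻¹≈ε⇒x≈y _ _ ν≡0)
    -- For y ≠ 1 this is (1 - μy) / (1 - y); the value at 1 is μ.
    t : Fin p → Fin p
    t y = ν F.* (F.1# F.- y) F.⁻¹ F.+ μ
    t-injective : Injective _≡_ _≡_ t
    t-injective {y} {y′} eq = FP.-‿injective (FP.+-cancelˡ F.1# _ _ (inverse-injective (FP.*-cancelʳ ν≢0
      (≡.trans (F.*-comm _ ν) (≡.trans (FP.+-cancelʳ μ _ _ eq) (F.*-comm ν _))))))
      where
      inverse-injective : ∀ {x x′} → x F.⁻¹ ≡ x′ F.⁻¹ → x ≡ x′
      inverse-injective {x} {x′} eq = ≡.trans (≡.sym (FP.⁻¹-involutive x)) (≡.trans (≡.cong F._⁻¹ eq) (FP.⁻¹-involutive x′))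
    pointwise : ∀ y → φ (t y) ≈ φ (F.1# F.- y) * φ (F.1# F.- μ F.* y) + 1# * ⟦ F.1# F.≟ y ⟧
    pointwise y with F.1# F.≟ y
    ... | yes ≡.refl = begin
      φ (t F.1#)
        ≡⟨ ≡.cong φ (≡.trans (≡.cong (λ s → ν F.* s F.+ μ) (FP.⁻¹-zero (F.-‿inverseʳ F.1#))) (≡.trans (≡.cong (F._+ μ) (F.zeroʳ ν)) (F.+-identityˡ μ))) ⟩
      φ μ              ≈⟨ φ-square m m≢0 ⟩
      1#               ≈⟨ +-identityˡ 1# ⟨
      0# + 1#          ≈⟨ +-cong (trans (*-congʳ (trans (reflexive (≡.cong φ (F.-‿inverseʳ F.1#))) φ-0)) (zeroˡ _)) (*-identityˡ 1#) ⟨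
      φ (F.1# F.- F.1#) * φ (F.1# F.- μ F.* F.1#) + 1# * 1# ∎
    ... | no 1≢y = begin
      φ (t y)          ≈⟨ φ-quotient 1-y≢0 t[1-y] ⟩
      φ (F.1# F.- y) * φ (F.1# F.- μ F.* y)              ≈⟨ +-identityʳ _ ⟨
      φ (F.1# F.- y) * φ (F.1# F.- μ F.* y) + 0#         ≈⟨ +-congˡ (zeroʳ 1#) ⟨
      φ (F.1# F.- y) * φ (F.1# F.- μ F.* y) + 1# * 0#    ∎
      where
      1-y≢0 : F.1# F.- y ≢ F.0#
      1-y≢0 eq = 1≢y (FP.x∙y⁻¹≈ε⇒x≈y _ _ eq)
      t[1-y] : t y F.* (F.1# F.- y) ≡ F.1# F.- μ F.* y
      t[1-y] = F≡.begin
        t y F.* (F.1# F.- y)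
          F≡.≡⟨ solve 4 (λ ν s r μ → (ν :* s :+ μ) :* r := ν :* (s :* r) :+ μ :* r) ≡.refl ν ((F.1# F.- y) F.⁻¹) (F.1# F.- y) μ ⟩
        ν F.* ((F.1# F.- y) F.⁻¹ F.* (F.1# F.- y)) F.+ μ F.* (F.1# F.- y)
          F≡.≡⟨ ≡.cong (λ s → ν F.* s F.+ μ F.* (F.1# F.- y)) (FP.*-inverseˡ 1-y≢0) ⟩
        ν F.* F.1# F.+ μ F.* (F.1# F.- y)
          F≡.≡⟨ solve 2 (λ μ y → (:1 :- μ) :* :1 :+ μ :* (:1 :- y) := :1 :- μ :* y) ≡.refl μ y ⟩
        F.1# F.- μ F.* y F≡.∎

  -- The point count as a character sum

  -- The character sum of w² = y (1 - y) (1 - μy).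
  legendreSum : Fin p → Carrier
  legendreSum μ = sum (λ y → φ y * (φ (F.1# F.- y) * φ (F.1# F.- μ F.* y)))

  -- The first line of the left side is the fibre over X/Z = ∞ and the second collects the fibres
  -- over (x : 1), each with its point Y/T = ∞ first.
  pointCount : ∀ {a} → a ≢ F.0# → F.1# ≢ (a F.* a) F.* (a F.* a) → let b = a F.* a in
    (⟦ b F.≟ F.0# ⟧ + sum (λ y → ⟦ y F.* y F.* b F.≟ F.1# ⟧)) +
    sum (λ x → ⟦ F.1# F.- b F.* (x F.* x) F.≟ F.0# ⟧ + sum (λ y → ⟦ y F.* y F.* (F.1# F.- b F.* (x F.* x)) F.≟ b F.- x F.* x ⟧))
    ≈ 1# + fromℕ# p + legendreSum (b F.* b)
  pointCount {a} a≢0 1≢μ = begin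
    (⟦ b F.≟ F.0# ⟧ + sum (λ y → ⟦ y F.* y F.* b F.≟ F.1# ⟧)) +
    sum (λ x → ⟦ A x F.≟ F.0# ⟧ + sum (λ y → ⟦ y F.* y F.* A x F.≟ B x ⟧))
      ≈⟨ +-cong (ℙ¹-count b F.1# (λ (_ , 1≡0) → F.1≉0 1≡0)) (sum-cong-≋ (λ x → ℙ¹-count (A x) (B x) (λ (A≡0 , B≡0) → 1≢μ (AB≢0 A≡0 B≡0)))) ⟩
    1# + φ b * φ F.1# + sum (λ x → 1# + h (x F.* x))
      -- Here `b` is a nonzero square, so the fibre over infinity has two points.
      ≈⟨ +-cong (+-congˡ (trans (*-cong (φ-square a a≢0) φ-1) (*-identityˡ 1#))) (∑-distrib-+ {p} (λ _ → 1#) (λ x → h (x F.* x))) ⟩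
    1# + 1# + (sum {p} (λ _ → 1#) + sum (λ x → h (x F.* x)))
      ≈⟨ +-congˡ (+-cong (sum-replicate p) (sum-squares h)) ⟩
    1# + 1# + (fromℕ# p + sum (λ u → (1# + φ u) * h u))
      ≈⟨ +-congˡ (+-congˡ (sum-reindex (λ u → (1# + φ u) * h u) (λ {x} {y} eq → FP.*-cancelʳ b≢0 (≡.trans (F.*-comm x b) (≡.trans eq (F.*-comm b y)))))) ⟨
    1# + 1# + (fromℕ# p + sum (λ y → (1# + φ (b F.* y)) * h (b F.* y)))
      ≈⟨ +-congˡ (+-congˡ (sum-cong-≋ expand)) ⟩
    1# + 1# + (fromℕ# p + sum (λ y → q y + φ y * q y))
      ≈⟨ +-congˡ (+-congˡ (∑-distrib-+ q (λ y → φ y * q y))) ⟩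
    1# + 1# + (fromℕ# p + (sum q + legendreSum μ))
      -- One of these two points completes `sum q` to the left side of `conicSum`.
      ≈⟨ KS.solve 4 (λ o n q l → o KS.:+ o KS.:+ (n KS.:+ (q KS.:+ l)) KS.:= (o KS.:+ n KS.:+ l) KS.:+ (q KS.:+ o)) refl 1# (fromℕ# p) (sum q) (legendreSum μ) ⟩
    1# + fromℕ# p + legendreSum μ + (sum q + 1#)
      ≈⟨ +-congˡ (conicSum {b} b≢0 1≢μ) ⟩
    1# + fromℕ# p + legendreSum μ + 0#
      ≈⟨ +-identityʳ _ ⟩
    1# + fromℕ# p + legendreSum μ ∎
    where
    b = a F.* a
    μ = b F.* b
    b≢0 : b ≢ F.0#
    b≢0 b≡0 = a≢0 (square-zero b≡0)
    A B : Fin p → Fin p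
    A x = F.1# F.- b F.* (x F.* x)
    B x = b F.- x F.* x
    h q : Fin p → Carrier
    h u = φ (F.1# F.- b F.* u) * φ (b F.- u)
    q y = φ (F.1# F.- y) * φ (F.1# F.- μ F.* y)
    -- A fibre filling the whole line would need `b x² = 1` and `x² = b`, hence `b² = 1`.
    AB≢0 : ∀ {x} → A x ≡ F.0# → B x ≡ F.0# → F.1# ≡ μ
    AB≢0 {x} A≡0 B≡0 = ≡.trans (FP.x∙y⁻¹≈ε⇒x≈y _ _ A≡0) (≡.cong (b F.*_) (≡.sym (FP.x∙y⁻¹≈ε⇒x≈y _ _ B≡0)))
    φ-b* : ∀ y → φ (b F.* y) ≈ φ y
    φ-b* y = trans (φ-* b y) (trans (*-congʳ (φ-square a a≢0)) (*-identityˡ _))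
    h-b* : ∀ y → h (b F.* y) ≈ q y
    h-b* y = begin
      φ (F.1# F.- b F.* (b F.* y)) * φ (b F.- b F.* y)
        ≡⟨ ≡.cong₂ (λ s t → φ s * φ t)
             (solve 2 (λ b y → :1 :- b :* (b :* y) := :1 :- b :* b :* y) ≡.refl b y)
             (solve 2 (λ b y → b :- b :* y := b :* (:1 :- y)) ≡.refl b y) ⟩
      φ (F.1# F.- μ F.* y) * φ (b F.* (F.1# F.- y))    ≈⟨ *-congˡ (φ-b* (F.1# F.- y)) ⟩
      φ (F.1# F.- μ F.* y) * φ (F.1# F.- y)            ≈⟨ *-comm _ _ ⟩
      q y                                              ∎
    expand : ∀ y → (1# + φ (b F.* y)) * h (b F.* y) ≈ q y + φ y * q y
    expand y = begin
      (1# + φ (b F.* y)) * h (b F.* y)    ≈⟨ *-cong (+-congˡ (φ-b* y)) (h-b* y) ⟩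
      (1# + φ y) * q y                    ≈⟨ distribʳ (q y) 1# (φ y) ⟩
      1# * q y + φ y * q y                ≈⟨ +-congʳ (*-identityˡ (q y)) ⟩
      q y + φ y * q y                     ∎

  -- The hypergeometric series as a character sum

  -- The argument 1 of the delta function produced by the sum over all
  -- characters in the hypergeometric series at 1 - μ.
  kernel : Fin p → Fin p → Fin p → Fin p
  kernel μ y z = (y F.* (F.1# F.- y) F.⁻¹) F.* (z F.* (F.1# F.- z) F.⁻¹) F.* (F.1# F.- μ)

  -- The bracket selects the single point z = (1 - y) / (1 - μy). In the exceptional cases `y = 0`,
  -- `y = 1` and `μy = 1` both sides vanish.
  kernelSum : ∀ {μ} → F.1# ≢ μ → ∀ y →
    sum (λ z → φ y * φ z * ⟦ F.1# F.≟ kernel μ y z ⟧) ≈ φ y * (φ (F.1# F.- y) * φ (F.1# F.- μ F.* y))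
  kernelSum {μ} 1≢μ y with y F.≟ F.0# | F.1# F.≟ y | (F.1# F.- μ F.* y) F.≟ F.0#
  ... | yes ≡.refl | _ | _ = trans
    (sum-zero {p} (λ z → trans (*-congʳ (trans (*-congʳ φ-0) (zeroˡ _))) (zeroˡ _)))
    (sym (trans (*-congʳ φ-0) (zeroˡ _)))
  ... | no _ | yes ≡.refl | _ = trans
    (sum-zero {p} (λ z → trans (*-congˡ (⟦⟧-no (F.1# F.≟ kernel μ F.1# z) (λ eq → F.1≉0 (≡.trans eq (kernel-1 z))))) (zeroʳ _)))
    (sym (trans (*-congˡ (trans (*-congʳ (trans (reflexive (≡.cong φ (F.-‿inverseʳ F.1#))) φ-0)) (zeroˡ _))) (zeroʳ _)))
    where
    kernel-1 : ∀ z → kernel μ F.1# z ≡ F.0#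
    kernel-1 z = ≡.trans (≡.cong (λ s → (F.1# F.* s) F.* (z F.* (F.1# F.- z) F.⁻¹) F.* (F.1# F.- μ)) (FP.⁻¹-zero (F.-‿inverseʳ F.1#)))
      (solve 3 (λ z s l → (:1 :* con ℤ.0ℤ) :* (z :* s) :* l := con ℤ.0ℤ) ≡.refl z ((F.1# F.- z) F.⁻¹) (F.1# F.- μ))
  ... | no y≢0 | no 1≢y | d = main d
    where
    D = F.1# F.- μ F.* y
    1-y≢0 : F.1# F.- y ≢ F.0#
    1-y≢0 eq = 1≢y (FP.x∙y⁻¹≈ε⇒x≈y _ _ eq)
    kernel-scaled : ∀ {z} → F.1# F.- z ≢ F.0# →
      kernel μ y z F.* ((F.1# F.- y) F.* (F.1# F.- z)) ≡ y F.* z F.* (F.1# F.- μ)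
    kernel-scaled {z} 1-z≢0 = F≡.begin
      kernel μ y z F.* ((F.1# F.- y) F.* (F.1# F.- z))
        F≡.≡⟨ solve 7 (λ y r r′ z s s′ l → (y :* r′) :* (z :* s′) :* l :* (r :* s) := y :* z :* l :* (r′ :* r) :* (s′ :* s)) ≡.refl
             y (F.1# F.- y) ((F.1# F.- y) F.⁻¹) z (F.1# F.- z) ((F.1# F.- z) F.⁻¹) (F.1# F.- μ) ⟩
      y F.* z F.* (F.1# F.- μ) F.* ((F.1# F.- y) F.⁻¹ F.* (F.1# F.- y)) F.* ((F.1# F.- z) F.⁻¹ F.* (F.1# F.- z))
        F≡.≡⟨ ≡.cong₂ (λ s t → y F.* z F.* (F.1# F.- μ) F.* s F.* t) (FP.*-inverseˡ 1-y≢0) (FP.*-inverseˡ 1-z≢0) ⟩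
      y F.* z F.* (F.1# F.- μ) F.* F.1# F.* F.1#
        F≡.≡⟨ ≡.trans (F.*-identityʳ _) (F.*-identityʳ _) ⟩
      y F.* z F.* (F.1# F.- μ) F≡.∎
    identity : ∀ z → y F.* z F.* (F.1# F.- μ) F.- (F.1# F.- y) F.* (F.1# F.- z) ≡ z F.* D F.- (F.1# F.- y)
    identity z = solve 3 (λ μ y z → y :* z :* (:1 :- μ) :- (:1 :- y) :* (:1 :- z) := z :* (:1 :- μ :* y) :- (:1 :- y)) ≡.refl μ y z
    kernel-1⇒ : ∀ {z} → F.1# ≡ kernel μ y z → z F.* D ≡ F.1# F.- y
    kernel-1⇒ {z} eq = FP.x∙y⁻¹≈ε⇒x≈y _ _ (≡.trans (≡.sym (identity z)) (FP.x≈y⇒x∙y⁻¹≈ε (F≡.begin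
      y F.* z F.* (F.1# F.- μ)                               F≡.≡⟨ kernel-scaled 1-z≢0 ⟨
      kernel μ y z F.* ((F.1# F.- y) F.* (F.1# F.- z))       F≡.≡⟨ ≡.cong (F._* ((F.1# F.- y) F.* (F.1# F.- z))) (≡.sym eq) ⟩
      F.1# F.* ((F.1# F.- y) F.* (F.1# F.- z))               F≡.≡⟨ F.*-identityˡ _ ⟩
      (F.1# F.- y) F.* (F.1# F.- z)                          F≡.∎)))
      where
      -- At `z = 1` the convention 0⁻¹ = 0 makes the kernel 0, so it cannot be 1.
      1-z≢0 : F.1# F.- z ≢ F.0#
      1-z≢0 1-z≡0 = F.1≉0 (≡.trans eq (≡.trans
        (≡.cong (λ s → (y F.* (F.1# F.- y) F.⁻¹) F.* (z F.* s) F.* (F.1# F.- μ)) (FP.⁻¹-zero 1-z≡0))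
        (solve 3 (λ t z l → t :* (z :* con ℤ.0ℤ) :* l := con ℤ.0ℤ) ≡.refl (y F.* (F.1# F.- y) F.⁻¹) z (F.1# F.- μ))))
    ⇒kernel-1 : ∀ {z} → z F.* D ≡ F.1# F.- y → F.1# ≡ kernel μ y z
    ⇒kernel-1 {z} eq = ≡.sym (FP.*-cancelʳ (nonzero-product 1-y≢0 1-z≢0) (F≡.begin
      kernel μ y z F.* ((F.1# F.- y) F.* (F.1# F.- z))       F≡.≡⟨ kernel-scaled 1-z≢0 ⟩
      y F.* z F.* (F.1# F.- μ)                               F≡.≡⟨ FP.x∙y⁻¹≈ε⇒x≈y _ _ (≡.trans (identity z) (FP.x≈y⇒x∙y⁻¹≈ε eq)) ⟩
      (F.1# F.- y) F.* (F.1# F.- z)                          F≡.≡⟨ F.*-identityˡ _ ⟨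
      F.1# F.* ((F.1# F.- y) F.* (F.1# F.- z))               F≡.∎))
      where
      nonzero-product : ∀ {u v} → u ≢ F.0# → v ≢ F.0# → u F.* v ≢ F.0#
      nonzero-product u≢0 v≢0 uv≡0 with FP.zeroProduct uv≡0
      ... | inj₁ u≡0 = u≢0 u≡0
      ... | inj₂ v≡0 = v≢0 v≡0
      -- Setting `z = 1` in `z D = 1 - y` would give `y (1 - μ) = 0`.
      1-z≢0 : F.1# F.- z ≢ F.0#
      1-z≢0 1-z≡0 = nonzero-product y≢0 (λ eq → 1≢μ (FP.x∙y⁻¹≈ε⇒x≈y _ _ eq)) (F≡.begin
        y F.* (F.1# F.- μ)       F≡.≡⟨ solve 2 (λ μ y → y :* (:1 :- μ) := :1 :* (:1 :- μ :* y) :- (:1 :- y)) ≡.refl μ y ⟩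
        F.1# F.* D F.- (F.1# F.- y)   F≡.≡⟨ ≡.cong (λ s → s F.* D F.- (F.1# F.- y)) (FP.x∙y⁻¹≈ε⇒x≈y _ _ 1-z≡0) ⟩
        z F.* D F.- (F.1# F.- y)      F≡.≡⟨ FP.x≈y⇒x∙y⁻¹≈ε eq ⟩
        F.0#                          F≡.∎)
    main : Dec (D ≡ F.0#) → sum (λ z → φ y * φ z * ⟦ F.1# F.≟ kernel μ y z ⟧) ≈ φ y * (φ (F.1# F.- y) * φ D)
    main (yes D≡0) = trans
      (sum-zero {p} (λ z → trans (*-congˡ (⟦⟧-no (F.1# F.≟ kernel μ y z) (λ eq → 1-y≢0 (≡.trans (≡.sym (kernel-1⇒ eq)) (≡.trans (≡.cong (z F.*_) D≡0) (F.zeroʳ z)))))) (zeroʳ _)))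
      (sym (trans (*-congˡ (trans (*-congˡ (trans (reflexive (≡.cong φ D≡0)) φ-0)) (zeroʳ _))) (zeroʳ _)))
    main (no D≢0) = begin
      sum (λ z → φ y * φ z * ⟦ F.1# F.≟ kernel μ y z ⟧)
        ≈⟨ sum-cong-≋ (λ z → *-congˡ {φ y * φ z} (⟦⟧-cong (F.1# F.≟ kernel μ y z) (z₀ F.≟ z)
             (λ eq → FP.*-cancelʳ D≢0 (≡.trans z₀D (≡.sym (kernel-1⇒ eq))))
             (λ { ≡.refl → ⇒kernel-1 z₀D }))) ⟩
      sum (λ z → φ y * φ z * ⟦ z₀ F.≟ z ⟧)     ≈⟨ sum-⟦≟⟧ (λ z → φ y * φ z) z₀ ⟩
      φ y * φ z₀                               ≈⟨ *-congˡ (φ-quotient D≢0 z₀D) ⟩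
      φ y * (φ D * φ (F.1# F.- y))             ≈⟨ *-congˡ (*-comm _ _) ⟩
      φ y * (φ (F.1# F.- y) * φ D)             ∎
      where
      z₀ = (F.1# F.- y) F.* D F.⁻¹
      z₀D : z₀ F.* D ≡ F.1# F.- y
      z₀D = ≡.trans (F.*-assoc _ _ D) (≡.trans (≡.cong ((F.1# F.- y) F.*_) (FP.*-inverseˡ D≢0)) (F.*-identityʳ _))

  -- Both inverses are 0 at 0, so the usual rule extends to the whole field.
  conjugate-χ : ∀ {χ} → Character χ → ∀ x → χ x ⁻¹ ≈ χ (x F.⁻¹)
  conjugate-χ {χ} χ-char x with x F.≟ F.0#
  ... | yes ≡.refl = trans (KP.⁻¹-zero (χ-0 χ-char)) (sym (χ-0 χ-char))
  ... | no x≢0     = KP.inverse-unique (begin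
    χ x * χ (proj₁ (F.inverse x x≢0))    ≈⟨ χ-* χ-char x _ ⟨
    χ (x F.* proj₁ (F.inverse x x≢0))    ≡⟨ ≡.cong χ (proj₂ (F.inverse x x≢0)) ⟩
    χ F.1#                               ≈⟨ χ-1 χ-char ⟩
    1#                                   ∎)

  χ[-1]*χ[-1]≈1 : ∀ {χ} → Character χ → χ (F.- F.1#) * χ (F.- F.1#) ≈ 1#
  χ[-1]*χ[-1]≈1 {χ} χ-char = begin
    χ (F.- F.1#) * χ (F.- F.1#)    ≈⟨ χ-* χ-char _ _ ⟨
    χ (F.- F.1# F.* F.- F.1#)      ≡⟨ ≡.cong χ (solve 0 (:- :1 :* :- :1 := :1) ≡.refl) ⟩
    χ F.1#                         ≈⟨ χ-1 χ-char ⟩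
    1#                             ∎

  -- The Jacobi sum of φχ and the conjugate of χ: the binomial coefficient of the series without its
  -- prefactor.
  jacobiSum : (Fin p → Carrier) → Carrier
  jacobiSum χ = sum (λ y → φ y * χ y * χ (F.1# F.- y) ⁻¹)

  -- Multiplicativity merges all values of `χ` in a term of the double sum into one value, the form
  -- in which orthogonality applies.
  jacobiSum-square : ∀ {χ} → Character χ → ∀ μ →
    jacobiSum χ * jacobiSum χ * χ (F.1# F.- μ) ≈ sum (λ y → sum (λ z → φ y * φ z * χ (kernel μ y z)))
  jacobiSum-square {χ} χ-char μ = begin
    J * J * X                                         ≈⟨ *-assoc J J X ⟩
    J * (J * X)                                       ≈⟨ *-distribʳ-sum (J * X) f ⟩
    sum (λ y → f y * (J * X))                         ≈⟨ sum-cong-≋ (λ y → *-congˡ {f y} (*-distribʳ-sum X f)) ⟩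
    sum (λ y → f y * sum (λ z → f z * X))             ≈⟨ sum-cong-≋ {p} (λ y → *-distribˡ-sum (f y) (λ z → f z * X)) ⟩
    sum (λ y → sum (λ z → f y * (f z * X)))           ≈⟨ sum-cong-≋ {p} (λ y → sum-cong-≋ {p} (pointwise y)) ⟩
    sum (λ y → sum (λ z → φ y * φ z * χ (kernel μ y z))) ∎
    where
    J = jacobiSum χ
    X = χ (F.1# F.- μ)
    f : Fin p → Carrier
    f y = φ y * χ y * χ (F.1# F.- y) ⁻¹
    r : Fin p → Fin p
    r y = (F.1# F.- y) F.⁻¹
    pointwise : ∀ y z → f y * (f z * X) ≈ φ y * φ z * χ (kernel μ y z)
    pointwise y z = begin
      f y * (f z * X)
        ≈⟨ *-cong (*-congˡ (conjugate-χ χ-char (F.1# F.- y))) (*-congʳ (*-congˡ (conjugate-χ χ-char (F.1# F.- z)))) ⟩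
      φ y * χ y * χ (r y) * (φ z * χ z * χ (r z) * X)
        ≈⟨ KS.solve 7 (λ a b c d e f x → a KS.:* b KS.:* c KS.:* (d KS.:* e KS.:* f KS.:* x) KS.:= a KS.:* d KS.:* (b KS.:* c KS.:* (e KS.:* f) KS.:* x)) refl
             (φ y) (χ y) (χ (r y)) (φ z) (χ z) (χ (r z)) X ⟩
      φ y * φ z * (χ y * χ (r y) * (χ z * χ (r z)) * X)
        ≈⟨ *-congˡ (*-congʳ (*-cong (χ-* χ-char y (r y)) (χ-* χ-char z (r z)))) ⟨
      φ y * φ z * (χ (y F.* r y) * χ (z F.* r z) * X)
        ≈⟨ *-congˡ (trans (χ-* χ-char _ _) (*-congʳ (χ-* χ-char _ _))) ⟨
      φ y * φ z * χ (kernel μ y z) ∎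

  module _ {L} (χ : Fin L → Fin p → Carrier)
    (χ-character : ∀ i → Character (χ i))
    (χ-complete  : ∀ {ψ} → Character ψ → ∃ λ i → ∀ x → χ i x ≈ ψ x)
    (χ-injective : ∀ i j → (∀ x → χ i x ≈ χ j x) → i ≡ j)
    {ζ : Carrier} (ζ-primitive : IsPrimitiveRootOfUnity N ζ) where
    open Orthogonality χ χ-character χ-complete χ-injective ζ-primitive

    -- For the listed characters this unfolds to `binom (φ ⊙ χ) χ`, so `hypergeometric` applies to
    -- `₂F₁` without conversion.
    binomial : Fin L → Carrier
    binomial i = χ i (F.- F.1#) * fromℕ# p ⁻¹ * jacobiSum (χ i)

    p·p⁻¹≈1 : fromℕ# p * fromℕ# p ⁻¹ ≈ 1#
    p·p⁻¹≈1 = KP.*-inverseʳ (charZero p {{ℕ.>-nonZero (ℕ.<⇒≤ 1<p)}})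

    -- The factor p² cancels the p⁻¹ of both coefficients, and the sign χ(-1) squares to 1.
    binomial-square : ∀ μ i → fromℕ# p * fromℕ# p * (binomial i * binomial i * χ i (F.1# F.- μ)) ≈
                      sum (λ y → sum (λ z → φ y * φ z * χ i (kernel μ y z)))
    binomial-square μ i = begin
      P * P * (ε * P′ * J * (ε * P′ * J) * X)
        ≈⟨ KS.solve 5 (λ p p′ ε j x → p KS.:* p KS.:* (ε KS.:* p′ KS.:* j KS.:* (ε KS.:* p′ KS.:* j) KS.:* x) KS.:=
             ε KS.:* ε KS.:* (p KS.:* p′) KS.:* (p KS.:* p′) KS.:* (j KS.:* j KS.:* x)) refl P P′ ε J X ⟩
      ε * ε * (P * P′) * (P * P′) * (J * J * X)
        ≈⟨ *-congʳ (trans (*-cong (trans (*-cong (χ[-1]*χ[-1]≈1 (χ-character i)) p·p⁻¹≈1) (*-identityˡ 1#)) p·p⁻¹≈1) (*-identityˡ 1#)) ⟩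
      1# * (J * J * X)      ≈⟨ *-identityˡ _ ⟩
      J * J * X             ≈⟨ jacobiSum-square (χ-character i) μ ⟩
      sum (λ y → sum (λ z → φ y * φ z * χ i (kernel μ y z))) ∎
      where
      P  = fromℕ# p
      P′ = P ⁻¹
      ε  = χ i (F.- F.1#)
      J  = jacobiSum (χ i)
      X  = χ i (F.1# F.- μ)

    -- The outer `p` and the numerator of p / (p - 1) provide the p² of `binomial-square`; the
    -- denominator cancels the factor `N` from orthogonality.
    hypergeometric : ∀ {μ} → F.1# ≢ μ →
      fromℕ# p * (fromℕ# p * fromℕ# N ⁻¹ * sum (λ i → binomial i * binomial i * χ i (F.1# F.- μ))) ≈ legendreSum μ
    hypergeometric {μ} 1≢μ = begin
      P * (P * N⁻¹ * sum t)
        ≈⟨ KS.solve 3 (λ p n s → p KS.:* (p KS.:* n KS.:* s) KS.:= n KS.:* (p KS.:* p KS.:* s)) refl P N⁻¹ (sum t) ⟩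
      N⁻¹ * (P * P * sum t)
        ≈⟨ *-congˡ (*-distribˡ-sum (P * P) t) ⟩
      N⁻¹ * sum (λ i → P * P * t i)
        ≈⟨ *-congˡ (sum-cong-≋ (binomial-square μ)) ⟩
      N⁻¹ * sum {L} (λ i → sum {p} (λ y → sum {p} (λ z → e y z * χ i (kernel μ y z))))
        ≈⟨ *-congˡ (∑-comm {L} {p} (λ i y → sum {p} (λ z → e y z * χ i (kernel μ y z)))) ⟩
      N⁻¹ * sum {p} (λ y → sum {L} (λ i → sum {p} (λ z → e y z * χ i (kernel μ y z))))
        ≈⟨ *-congˡ (sum-cong-≋ {p} row) ⟩
      N⁻¹ * sum {p} (λ y → fromℕ# N * f y)
        ≈⟨ *-congˡ (*-distribˡ-sum {p} (fromℕ# N) f) ⟨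
      N⁻¹ * (fromℕ# N * legendreSum μ)
        ≈⟨ *-assoc _ _ _ ⟨
      N⁻¹ * fromℕ# N * legendreSum μ
        ≈⟨ *-congʳ (KP.*-inverseˡ (charZero N {{ℕ.>-nonZero 0<N}})) ⟩
      1# * legendreSum μ     ≈⟨ *-identityˡ _ ⟩
      legendreSum μ          ∎
      where
      P   = fromℕ# p
      N⁻¹ = fromℕ# N ⁻¹
      t : Fin L → Carrier
      t i = binomial i * binomial i * χ i (F.1# F.- μ)
      e : Fin p → Fin p → Carrier
      e y z = φ y * φ z
      f : Fin p → Carrier
      f y = φ y * (φ (F.1# F.- y) * φ (F.1# F.- μ F.* y))
      row : ∀ y → sum {L} (λ i → sum {p} (λ z → e y z * χ i (kernel μ y z))) ≈ fromℕ# N * f y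
      row y = begin
        sum {L} (λ i → sum {p} (λ z → e y z * χ i (kernel μ y z)))
          ≈⟨ ∑-comm {L} {p} (λ i z → e y z * χ i (kernel μ y z)) ⟩
        sum {p} (λ z → sum {L} (λ i → e y z * χ i (kernel μ y z)))
          ≈⟨ sum-cong-≋ {p} (λ z → *-distribˡ-sum {L} (e y z) (λ i → χ i (kernel μ y z))) ⟨
        sum {p} (λ z → e y z * sum {L} (λ i → χ i (kernel μ y z)))
          ≈⟨ sum-cong-≋ {p} (λ z → trans (*-congˡ {e y z} (orthogonality (kernel μ y z))) (x∙yz≈y∙xz _ _ _)) ⟩
        sum {p} (λ z → fromℕ# N * (e y z * ⟦ F.1# F.≟ kernel μ y z ⟧))
          ≈⟨ *-distribˡ-sum {p} (fromℕ# N) (λ z → e y z * ⟦ F.1# F.≟ kernel μ y z ⟧) ⟨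
        fromℕ# N * sum {p} (λ z → e y z * ⟦ F.1# F.≟ kernel μ y z ⟧)
          ≈⟨ *-congˡ (kernelSum 1≢μ y) ⟩
        fromℕ# N * f y ∎

-- The curve equation in the four charts

module EdwardsEquation (R : CommutativeRing c ℓ) where
  open CommutativeRing R
  open RingProperties ring using (x∙y⁻¹≈ε⇒x≈y; x≈y⇒x∙y⁻¹≈ε)
  open Exp semiring using (_^_)
  open IntegerSolver R
  private
    :1 :0 : ∀ {n} → Polynomial n
    :1 = con ℤ.1ℤ
    :0 = con ℤ.0ℤ

  -- It reduces each chart to one polynomial identity between differences, which the solver proves.
  transfer : ∀ {x y u v} → x - y ≈ u - v → x ≈ y ⇔ u ≈ v
  transfer eq = mk⇔
    (λ x≈y → x∙y⁻¹≈ε⇒x≈y _ _ (trans (sym eq) (x≈y⇒x∙y⁻¹≈ε x≈y)))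
    (λ u≈v → x∙y⁻¹≈ε⇒x≈y _ _ (trans eq (x≈y⇒x∙y⁻¹≈ε u≈v)))

  onEdwards-∞∞ : ∀ a → OnEdwards R a (1# , 0#) (1# , 0#) ⇔ 0# ≈ a * a
  onEdwards-∞∞ a = transfer (solve 1 (λ a →
    (:1 :^ 2 :* :0 :^ 2 :+ :1 :^ 2 :* :0 :^ 2) :- (a :^ 2 :* (:0 :^ 2 :* :0 :^ 2 :+ :1 :^ 2 :* :1 :^ 2))
    := :0 :- a :* a) refl a)

  onEdwards-∞ : ∀ a y → OnEdwards R a (1# , 0#) (y , 1#) ⇔ 1# ≈ y * y * (a * a)
  onEdwards-∞ a y = transfer (solve 2 (λ a y →
    (:1 :^ 2 :* :1 :^ 2 :+ y :^ 2 :* :0 :^ 2) :- (a :^ 2 :* (:0 :^ 2 :* :1 :^ 2 :+ :1 :^ 2 :* y :^ 2))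
    := :1 :- y :* y :* (a :* a)) refl a y)

  onEdwards-x∞ : ∀ a x → OnEdwards R a (x , 1#) (1# , 0#) ⇔ 1# - (a * a) * (x * x) ≈ 0#
  onEdwards-x∞ a x = transfer (solve 2 (λ a x →
    (x :^ 2 :* :0 :^ 2 :+ :1 :^ 2 :* :1 :^ 2) :- (a :^ 2 :* (:1 :^ 2 :* :0 :^ 2 :+ x :^ 2 :* :1 :^ 2))
    := (:1 :- (a :* a) :* (x :* x)) :- :0) refl a x)

  onEdwards-xy : ∀ a x y → OnEdwards R a (x , 1#) (y , 1#) ⇔ y * y * (1# - (a * a) * (x * x)) ≈ a * a - x * x
  onEdwards-xy a x y = transfer (solve 3 (λ a x y →
    (x :^ 2 :* :1 :^ 2 :+ y :^ 2 :* :1 :^ 2) :- (a :^ 2 :* (:1 :^ 2 :* :1 :^ 2 :+ x :^ 2 :* y :^ 2))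
    := y :* y :* (:1 :- (a :* a) :* (x :* x)) :- (a :* a :- x :* x)) refl a x y)

  a⁵ : ∀ a → a ^ 5 ≈ a * ((a * a) * (a * a))
  a⁵ = solve 1 (λ a → a :^ 5 := a :* ((a :* a) :* (a :* a))) refl

  a⁴ : ∀ a → a ^ 4 ≈ (a * a) * (a * a)
  a⁴ = solve 1 (λ a → a :^ 4 := (a :* a) :* (a :* a)) refl

-- Sums over lists

module ListSums (R : Semiring c ℓ) where
  open Semiring R
  open FiniteSums R
  open Sum R
  open Mult R using () renaming (_×_ to _·_)
  private variable
    α β : Level
    A : Set α
    B : Set β

  listSum : (A → Carrier) → List A → Carrier
  listSum f []       = 0#
  listSum f (x ∷ xs) = f x + listSum f xs

  listSum-++ : (f : A → Carrier) → ∀ xs ys → listSum f (xs ++ ys) ≈ listSum f xs + listSum f ys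
  listSum-++ f []       ys = sym (+-identityˡ _)
  listSum-++ f (x ∷ xs) ys = trans (+-congˡ (listSum-++ f xs ys)) (sym (+-assoc _ _ _))

  listSum-map : (f : B → Carrier) (g : A → B) → ∀ xs → listSum f (map g xs) ≡ listSum (f ∘ g) xs
  listSum-map f g []       = ≡.refl
  listSum-map f g (x ∷ xs) = ≡.cong (f (g x) +_) (listSum-map f g xs)

  listSum-tabulate : (f : A → Carrier) → ∀ {n} (g : Fin n → A) → listSum f (tabulate g) ≡ sum (f ∘ g)
  listSum-tabulate f {zero}  g = ≡.refl
  listSum-tabulate f {suc n} g = ≡.cong (f (g Fin.zero) +_) (listSum-tabulate f (g ∘ Fin.suc))

  listSum-cartesianProduct : (f : A × B → Carrier) → ∀ xs ys →
    listSum f (cartesianProduct xs ys) ≈ listSum (λ x → listSum (λ y → f (x , y)) ys) xs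
  listSum-cartesianProduct f []       ys = refl
  listSum-cartesianProduct f (x ∷ xs) ys = trans (listSum-++ f (map (x ,_) ys) (cartesianProduct xs ys))
    (+-cong (reflexive (listSum-map f (x ,_) ys)) (listSum-cartesianProduct f xs ys))

  length-filter : ∀ {p} {P : Pred A p} (P? : Decidable P) xs → length (filter P? xs) · 1# ≈ listSum (λ x → ⟦ P? x ⟧) xs
  length-filter P? []       = refl
  length-filter P? (x ∷ xs) with P? x
  ... | yes _ = +-congˡ (length-filter P? xs)
  ... | no _  = trans (length-filter P? xs) (sym (+-identityˡ _))

module _ (S : Setoid c ℓ) where
  open Setoid S

  lookup-injective : ∀ {xs} → Unique S xs → ∀ i j → lookup xs i ≈ lookup xs j → i ≡ j
  lookup-injective (x∉xs ∷ xs!) Fin.zero    Fin.zero    eq = ≡.refl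
  lookup-injective (x∉xs ∷ xs!) Fin.zero    (Fin.suc j) eq = contradiction eq (All.lookup x∉xs (Membership.∈-lookup j))
  lookup-injective (x∉xs ∷ xs!) (Fin.suc i) Fin.zero    eq = contradiction (sym eq) (All.lookup x∉xs (Membership.∈-lookup i))
  lookup-injective (x∉xs ∷ xs!) (Fin.suc i) (Fin.suc j) eq = ≡.cong Fin.suc (lookup-injective xs! i j eq)

-- The count and the series for the curve

module Edwards (p : ℕ) .{{_ : NonZero p}} (prime : Prime p) (2∤p : ¬ 2 ∣ p)
  (K : Field c ℓ) (charZero : Field.CharacteristicZero K)
  (ζ : Field.Carrier K) (ζ-primitive : Field.IsPrimitiveRootOfUnity K (p ℕ.∸ 1) ζ) where
  open ResidueField p prime using (primeField)
  open PowerSums primeField using (1+N≡p)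
  open Field K
  open FiniteSums semiring
  open ListSums semiring
  open Sum semiring
  open SetoidReasoning setoid
  open Characters primeField K using (Character; IsQuadratic)
  private
    module F = Field (PrimeField.field𝔽 primeField)
    module FP = RingProperties F.ring
    module E = EdwardsEquation F.commutativeRing

  φ-0 : φ p K F.0# ≈ 0#
  φ-0 with F.0# Fin.≟ F.0# | Fin.any? (λ y → y F.* y Fin.≟ F.0#)
  ... | yes _  | _ = refl
  ... | no 0≢0 | _ = contradiction ≡.refl 0≢0

  φ-square : ∀ x → x ≢ F.0# → φ p K (x F.* x) ≈ 1#
  φ-square x x≢0 with x F.* x Fin.≟ F.0# | Fin.any? (λ y → y F.* y Fin.≟ x F.* x)
  ... | no _      | yes _    = refl
  ... | no _      | no none  = contradiction (x , ≡.refl) none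
  ... | yes xx≡0  | _ with FieldProperties.zeroProduct (PrimeField.field𝔽 primeField) {x} {x} xx≡0
  ...   | inj₁ x≡0 = contradiction x≡0 x≢0
  ...   | inj₂ x≡0 = contradiction x≡0 x≢0

  φ-nonsquare : ∀ x → (∀ y → y F.* y ≢ x) → φ p K x ≈ - 1#
  φ-nonsquare x nonsquare with x Fin.≟ F.0# | Fin.any? (λ y → y F.* y Fin.≟ x)
  ... | yes x≡0 | _              = contradiction (≡.trans (F.zeroˡ F.0#) (≡.sym x≡0)) (nonsquare F.0#)
  ... | no _    | yes (y , yy≡x) = contradiction yy≡x (nonsquare y)
  ... | no _    | no _           = refl

  φ-isQuadratic : IsQuadratic (φ p K)
  φ-isQuadratic = record { φ-0 = φ-0 ; φ-square = φ-square ; φ-nonsquare = φ-nonsquare }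

  N-even : ∃ λ j → p ℕ.∸ 1 ≡ j ℕ.+ j
  N-even with parity (p ℕ.∸ 1)
  ... | j , inj₁ even = j , even
  ... | j , inj₂ odd  = contradiction (divides (suc j) (≡.trans (≡.sym 1+N≡p) (≡.cong suc (≡.trans odd
          (≡.cong suc (≡.trans (≡.cong (j ℕ.+_) (≡.sym (ℕ.+-identityʳ j))) (ℕ.*-comm 2 j))))))) 2∤p

  open QuadraticCharacter primeField K charZero N-even (φ p K) φ-isQuadratic
    using (legendreSum; pointCount; hypergeometric)

  toCharacter : ∀ {χ} → IsCharacter p K χ → Character χ
  toCharacter χ-char = record { χ-0 = χ-0 ; χ-1 = χ-1 ; χ-* = χ-* }
    where open IsCharacter χ-char

  fromCharacter : ∀ {χ} → Character χ → IsCharacter p K χ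
  fromCharacter χ-char = record { χ-0 = χ-0 ; χ-1 = χ-1 ; χ-* = χ-* }
    where open Characters.Character χ-char

  private
    cs = characters p K ζ
    open CharacterProperties p prime K using (characters-unique; ∈-characters)

  lookup-character : ∀ i → Character (lookup cs i)
  lookup-character i = toCharacter (All.lookup (All.all-filter (isCharacter? p K) (functions p K p (values p K ζ))) (Membership.∈-lookup i))

  lookup-complete : ∀ {ψ} → Character ψ → ∃ λ i → ∀ x → lookup cs i x ≈ ψ x
  lookup-complete ψ-char = Any.index ψ∈ , λ x → sym (Any.lookup-index ψ∈ x)
    where ψ∈ = ∈-characters charZero ζ-primitive (fromCharacter ψ-char)

  ₂F₁≈legendreSum : ∀ {μ} → F.1# ≢ μ → fromℕ# p * ₂F₁ p K ζ (F.1# F.- μ) ≈ legendreSum μ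
  ₂F₁≈legendreSum = hypergeometric (lookup cs) lookup-character lookup-complete
    (lookup-injective (≋-setoid p) (characters-unique charZero ζ-primitive)) ζ-primitive
    where open VectorEquality setoid using (≋-setoid)

  listSum-ℙ¹ : ∀ f → listSum f (ℙ¹ p) ≈ f (F.1# , F.0#) + sum (λ x → f (x , F.1#))
  listSum-ℙ¹ f = +-congˡ (reflexive (≡.trans (listSum-map f (_, F.1#) (allFin p)) (listSum-tabulate (λ x → f (x , F.1#)) (λ x → x))))

  ∣Edwards∣≈ : ∀ {a} → a ≢ F.0# → F.1# ≢ (a F.* a) F.* (a F.* a) →
    fromℕ# (∣Edwards∣ p a) ≈ 1# + fromℕ# p + legendreSum ((a F.* a) F.* (a F.* a))
  ∣Edwards∣≈ {a} a≢0 1≢a⁴ = begin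
    fromℕ# (∣Edwards∣ p a)                                  ≈⟨ length-filter (onEdwards? p a) (cartesianProduct (ℙ¹ p) (ℙ¹ p)) ⟩
    listSum on (cartesianProduct (ℙ¹ p) (ℙ¹ p))             ≈⟨ listSum-cartesianProduct on (ℙ¹ p) (ℙ¹ p) ⟩
    listSum (λ P → listSum (λ Q → on (P , Q)) (ℙ¹ p)) (ℙ¹ p)
      ≈⟨ listSum-ℙ¹ (λ P → listSum (λ Q → on (P , Q)) (ℙ¹ p)) ⟩
    listSum (λ Q → on (∞ , Q)) (ℙ¹ p) + sum (λ x → listSum (λ Q → on ((x , F.1#) , Q)) (ℙ¹ p))
      ≈⟨ +-cong (row ∞) (sum-cong-≋ (λ x → row (x , F.1#))) ⟩
    (on (∞ , ∞) + sum (λ y → on (∞ , (y , F.1#)))) +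
    sum (λ x → on ((x , F.1#) , ∞) + sum (λ y → on ((x , F.1#) , (y , F.1#))))
      ≈⟨ +-cong
           (+-cong (bracket (∞ , ∞) (b F.≟ F.0#) (swap (E.onEdwards-∞∞ a)))
                   (sum-cong-≋ (λ y → bracket (∞ , (y , F.1#)) (y F.* y F.* b F.≟ F.1#) (swap (E.onEdwards-∞ a y)))))
           (sum-cong-≋ (λ x →
             +-cong (bracket ((x , F.1#) , ∞) (F.1# F.- b F.* (x F.* x) F.≟ F.0#) (E.onEdwards-x∞ a x))
                    (sum-cong-≋ (λ y → bracket ((x , F.1#) , (y , F.1#)) (y F.* y F.* (F.1# F.- b F.* (x F.* x)) F.≟ b F.- x F.* x) (E.onEdwards-xy a x y))))) ⟩
    (⟦ b F.≟ F.0# ⟧ + sum (λ y → ⟦ y F.* y F.* b F.≟ F.1# ⟧)) +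
    sum (λ x → ⟦ F.1# F.- b F.* (x F.* x) F.≟ F.0# ⟧ + sum (λ y → ⟦ y F.* y F.* (F.1# F.- b F.* (x F.* x)) F.≟ b F.- x F.* x ⟧))
      ≈⟨ pointCount a≢0 1≢a⁴ ⟩
    1# + fromℕ# p + legendreSum (b F.* b) ∎
    where
    b = a F.* a
    ∞ : Fin p × Fin p
    ∞ = F.1# , F.0#
    on : (Fin p × Fin p) × (Fin p × Fin p) → Carrier
    on PQ = ⟦ onEdwards? p a PQ ⟧
    row : ∀ P → listSum (λ Q → on (P , Q)) (ℙ¹ p) ≈ on (P , ∞) + sum (λ y → on (P , (y , F.1#)))
    row P = listSum-ℙ¹ (λ Q → on (P , Q))
    swap : ∀ {X : Set} {u v : Fin p} → X ⇔ (u ≡ v) → X ⇔ (v ≡ u)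
    swap e = mk⇔ (λ x → ≡.sym (Equivalence.to e x)) (λ eq → Equivalence.from e (≡.sym eq))
    bracket : ∀ PQ {X : Set} (X? : Dec X) → uncurry (OnEdwards (𝔽 p) a) PQ ⇔ X → on PQ ≈ ⟦ X? ⟧
    bracket PQ X? e = ⟦⟧-cong (onEdwards? p a PQ) X? (Equivalence.to e) (Equivalence.from e)

theorem1 : ∀ {c ℓ} (p : ℕ) .{{_ : NonZero p}} → Prime p → ¬ 2 ∣ p →
    let module F = CommutativeRing (𝔽 p)
        open Exp F.semiring using () renaming (_^_ to _^F_)
    in (a : Fin p) → a ^F 5 ≢ a →
    (K : Field c ℓ) → Field.CharacteristicZero K →
    (ζ : Field.Carrier K) → Field.IsPrimitiveRootOfUnity K (p ∸ 1) ζ →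
    let open Field K
    in fromℕ# (∣Edwards∣ p a) ≈
       1# + fromℕ# p + fromℕ# p * ₂F₁ p K ζ (F.1# F.- a ^F 4)
theorem1 p p-prime 2∤p a a⁵≢a K charZero ζ ζ-primitive = trans (∣Edwards∣≈ a≢0 1≢μ)
  (+-congˡ (trans (sym (₂F₁≈legendreSum 1≢μ)) (*-congˡ (reflexive (≡.cong (λ μ → ₂F₁ p K ζ (F.1# F.- μ)) (≡.sym (a⁴ a)))))))
  where
  open Edwards p p-prime 2∤p K charZero ζ ζ-primitive
  open Field K
  module F = CommutativeRing (𝔽 p)
  open EdwardsEquation (𝔽 p) using (a⁴; a⁵)
  -- Since `a ^ 5 = a μ`, each of `μ = 1` and `a = 0` would give `a ^ 5 = a`.
  1≢μ : F.1# ≢ (a F.* a) F.* (a F.* a)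
  1≢μ 1≡μ = a⁵≢a (≡.trans (a⁵ a) (≡.trans (≡.cong (a F.*_) (≡.sym 1≡μ)) (F.*-identityʳ a)))
  a≢0 : a ≢ F.0#
  a≢0 a≡0 = a⁵≢a (≡.trans (a⁵ a) (≡.trans (≡.cong (F._* ((a F.* a) F.* (a F.* a))) a≡0) (≡.trans (F.zeroˡ ((a F.* a) F.* (a F.* a))) (≡.sym a≡0))))
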